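{- Let $p=p(n)=o\!\left(\frac1n\right)$. Then for all sufficiently large $n\in\mathbb{N}$ we have $u_2(n,p)=0$ and $u_2'(n,p)=0$.
   Context: $G(n,p)$ is the Erdős–Rényi random graph on $n$ labelled vertices (vertex set $V$), each edge present independently with probability $p=p(n)$; $\mathbb{P}_{n,p}$ is the corresponding probability and $q=1-p$. A diameter graph in $\mathbb{R}^d$ is a graph $(V,E)$ with $V\subset\mathbb{R}^d$ finite and $E=\{\{\mathbf{x},\mathbf{y}\}\subseteq V: |\mathbf{x}-\mathbf{y}|=\operatorname{diam}V\}$, where $\operatorname{diam}V=\max_{\mathbf{x},\mathbf{y}\in V}|\mathbf{x}-\mathbf{y}|$ (Euclidean norm); a graph is a diameter graph in $\mathbb{R}^d$ if it is isomorphic to one. $u_d(n,p)$ is the largest positive integer $k$ such that $\mathbb{P}_{n,p}\big(\exists W\subseteq V,\ |W|=k,\ G[W]$ is a diameter graph in $\mathbb{R}^d$ and $\chi(G[W])=d+1\big)>\frac12$, where $G[W]$ is the induced subgraph; if no such $k$ exists, $u_d(n,p)=0$. $u_d'(n,p)$ is defined identically with the additional requirement that $G[W]$ be connected. -}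

module Defs where

open import Data.Bool.Base using (Bool; true; false; if_then_else_)
open import Data.Fin.Base using (Fin; zero; suc)
open import Data.Fin.Subset using (Subset; _∈_; ∣_∣)
open import Data.Integer.Base using (+_)
open import Data.List.Base using (List; []; _∷_; map; foldr; filter; cartesianProductWith)
open import Data.Nat.Base as ℕ using (ℕ; zero; suc; _⊔_)
import Data.Nat.Properties as ℕₚ
open import Data.Product.Base using (Σ; Σ-syntax; ∃-syntax; _×_; _,_; proj₁; proj₂)
open import Data.Rational.Base as ℚ using (ℚ; 0ℚ; 1ℚ; ½)
import Data.Rational.Properties as ℚₚ
open import Data.Rational.Solver using (module +-*-Solver)
open import Data.Sum.Base using (_⊎_)
open import Data.Vec.Base using (Vec; []; _∷_; lookup)
import Data.Vec.Functional as Vector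
open import Function.Bundles using (_↔_; _⇔_; Inverse)
open import Function.Definitions using (Injective)
open import Relation.Binary.Construct.Closure.ReflexiveTransitive using (Star)
open import Relation.Binary.PropositionalEquality
  using (_≡_; _≢_; refl; sym; trans; cong; cong₂; subst)
open import Relation.Nullary using (¬_)
open import Relation.Unary using (Pred; Decidable)
open import Level using (0ℓ)

------------------------------------------------------------------------
-- Real numbers: Cauchy sequences of rationals, with _≃_ as equality

Eventually : (ℕ → Set) → Set
Eventually P = ∃[ N ] ∀ n → N ℕ.≤ n → P n

IsCauchy : (ℕ → ℚ) → Set
IsCauchy a = ∀ ε → 0ℚ ℚ.< ε →
  ∃[ N ] ∀ m n → N ℕ.≤ m → N ℕ.≤ n → ℚ.∣ a m ℚ.- a n ∣ ℚ.≤ ε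

record ℝ : Set where
  constructor mkℝ
  field
    seq    : ℕ → ℚ
    cauchy : IsCauchy seq

open ℝ public

infix  4 _≃_ _≤_ _<_
infixl 6 _+_ _-_
infixl 7 _*_
infix  8 -_

_≃_ : ℝ → ℝ → Set
x ≃ y = ∀ ε → 0ℚ ℚ.< ε → Eventually λ n → ℚ.∣ seq x n ℚ.- seq y n ∣ ℚ.≤ ε

_≤_ : ℝ → ℝ → Set
x ≤ y = ∀ ε → 0ℚ ℚ.< ε → Eventually λ n → seq x n ℚ.≤ seq y n ℚ.+ ε

_<_ : ℝ → ℝ → Set
x < y = ∃[ ε ] 0ℚ ℚ.< ε × Eventually λ n → seq x n ℚ.+ ε ℚ.≤ seq y n

fromℚ : ℚ → ℝ
fromℚ r = mkℝ (λ _ → r) λ ε 0<ε → 0 , λ _ _ _ _ →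
  subst (ℚ._≤ ε) (sym (cong ℚ.∣_∣ (ℚₚ.+-inverseʳ r))) (ℚₚ.<⇒≤ 0<ε)

0ℝ 1ℝ ½ℝ : ℝ
0ℝ = fromℚ 0ℚ
1ℝ = fromℚ 1ℚ
½ℝ = fromℚ ½

private
  open +-*-Solver using (solve; _:+_; _:*_; _:-_; _:=_)

  0<½* : ∀ ε → 0ℚ ℚ.< ε → 0ℚ ℚ.< ½ ℚ.* ε
  0<½* ε 0<ε = ℚₚ.positive⁻¹ _ {{ℚₚ.pos*pos⇒pos ½ ε {{ℚ.positive 0<ε}}}}

  halves : ∀ ε → ½ ℚ.* ε ℚ.+ ½ ℚ.* ε ≡ ε
  halves ε = trans (sym (ℚₚ.*-distribʳ-+ ε ½ ½)) (ℚₚ.*-identityˡ ε)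

  *-mono-∣∣ : ∀ {a b s t} → ℚ.∣ a ∣ ℚ.≤ s → ℚ.∣ b ∣ ℚ.≤ t → ℚ.∣ a ℚ.* b ∣ ℚ.≤ s ℚ.* t
  *-mono-∣∣ {a} {b} {s} {t} a≤s b≤t = begin
    ℚ.∣ a ℚ.* b ∣       ≡⟨ ℚₚ.∣p*q∣≡∣p∣*∣q∣ a b ⟩
    ℚ.∣ a ∣ ℚ.* ℚ.∣ b ∣ ≤⟨ ℚₚ.*-monoˡ-≤-nonNeg ℚ.∣ a ∣ {{ℚ.nonNegative (ℚₚ.0≤∣p∣ a)}} b≤t ⟩
    ℚ.∣ a ∣ ℚ.* t       ≤⟨ ℚₚ.*-monoʳ-≤-nonNeg t
                            {{ℚ.nonNegative (ℚₚ.≤-trans (ℚₚ.0≤∣p∣ b) b≤t)}} a≤s ⟩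
    s ℚ.* t             ∎
    where open ℚₚ.≤-Reasoning

  +-cauchy : ∀ {a b} → IsCauchy a → IsCauchy b → IsCauchy (λ n → a n ℚ.+ b n)
  +-cauchy {a} {b} ca cb ε 0<ε = N₁ ⊔ N₂ , λ m n N≤m N≤n → begin
    ℚ.∣ (a m ℚ.+ b m) ℚ.- (a n ℚ.+ b n) ∣
      ≡⟨ cong ℚ.∣_∣ (solve 4 (λ x y z w → (x :+ y) :- (z :+ w) := (x :- z) :+ (y :- w))
                            refl (a m) (b m) (a n) (b n)) ⟩
    ℚ.∣ (a m ℚ.- a n) ℚ.+ (b m ℚ.- b n) ∣
      ≤⟨ ℚₚ.∣p+q∣≤∣p∣+∣q∣ (a m ℚ.- a n) (b m ℚ.- b n) ⟩
    ℚ.∣ a m ℚ.- a n ∣ ℚ.+ ℚ.∣ b m ℚ.- b n ∣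
      ≤⟨ ℚₚ.+-mono-≤
           (h₁ m n (ℕₚ.m⊔n≤o⇒m≤o N₁ N₂ N≤m) (ℕₚ.m⊔n≤o⇒m≤o N₁ N₂ N≤n))
           (h₂ m n (ℕₚ.m⊔n≤o⇒n≤o N₁ N₂ N≤m) (ℕₚ.m⊔n≤o⇒n≤o N₁ N₂ N≤n)) ⟩
    ½ ℚ.* ε ℚ.+ ½ ℚ.* ε
      ≡⟨ halves ε ⟩
    ε ∎
    where
    open ℚₚ.≤-Reasoning
    δ = 0<½* ε 0<ε
    N₁ = proj₁ (ca _ δ)
    h₁ = proj₂ (ca _ δ)
    N₂ = proj₁ (cb _ δ)
    h₂ = proj₂ (cb _ δ)

  neg-cauchy : ∀ {a} → IsCauchy a → IsCauchy (λ n → ℚ.- a n)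
  neg-cauchy {a} ca ε 0<ε with ca ε 0<ε
  ... | N , h = N , λ m n N≤m N≤n → begin
    ℚ.∣ (ℚ.- a m) ℚ.- (ℚ.- a n) ∣ ≡⟨ cong ℚ.∣_∣ (sym (ℚₚ.neg-distrib-+ (a m) (ℚ.- a n))) ⟩
    ℚ.∣ ℚ.- (a m ℚ.- a n) ∣       ≡⟨ ℚₚ.∣-p∣≡∣p∣ (a m ℚ.- a n) ⟩
    ℚ.∣ a m ℚ.- a n ∣             ≤⟨ h m n N≤m N≤n ⟩
    ε                             ∎
    where open ℚₚ.≤-Reasoning

  cauchy⇒bounded : ∀ {a} → IsCauchy a → ∃[ B ] ℚ.Positive B × Eventually λ n → ℚ.∣ a n ∣ ℚ.≤ B
  cauchy⇒bounded {a} ca with ca 1ℚ (ℚₚ.positive⁻¹ 1ℚ)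
  ... | N , h = ℚ.∣ a N ∣ ℚ.+ 1ℚ
              , ℚ.positive (ℚₚ.+-mono-≤-< (ℚₚ.0≤∣p∣ (a N)) (ℚₚ.positive⁻¹ 1ℚ))
              , N , λ n N≤n → begin
    ℚ.∣ a n ∣
      ≡⟨ cong ℚ.∣_∣ (solve 2 (λ x y → x := y :+ (x :- y)) refl (a n) (a N)) ⟩
    ℚ.∣ a N ℚ.+ (a n ℚ.- a N) ∣
      ≤⟨ ℚₚ.∣p+q∣≤∣p∣+∣q∣ (a N) (a n ℚ.- a N) ⟩
    ℚ.∣ a N ∣ ℚ.+ ℚ.∣ a n ℚ.- a N ∣
      ≤⟨ ℚₚ.+-monoʳ-≤ ℚ.∣ a N ∣ (h n N N≤n ℕₚ.≤-refl) ⟩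
    ℚ.∣ a N ∣ ℚ.+ 1ℚ ∎
    where open ℚₚ.≤-Reasoning

  *-diff : ∀ x y z w → x ℚ.* y ℚ.- z ℚ.* w ≡ x ℚ.* (y ℚ.- w) ℚ.+ (x ℚ.- z) ℚ.* w
  *-diff = solve 4 (λ x y z w → x :* y :- z :* w := x :* (y :- w) :+ (x :- z) :* w) refl

  *-close : ∀ x y z w {A B δ} → ℚ.∣ x ∣ ℚ.≤ A → ℚ.∣ w ∣ ℚ.≤ B →
            ℚ.∣ x ℚ.- z ∣ ℚ.≤ δ → ℚ.∣ y ℚ.- w ∣ ℚ.≤ δ →
            ℚ.∣ x ℚ.* y ℚ.- z ℚ.* w ∣ ℚ.≤ δ ℚ.* (A ℚ.+ B)
  *-close x y z w {A} {B} {δ} x≤A w≤B xz≤δ yw≤δ = begin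
    ℚ.∣ x ℚ.* y ℚ.- z ℚ.* w ∣
      ≡⟨ cong ℚ.∣_∣ (*-diff x y z w) ⟩
    ℚ.∣ x ℚ.* (y ℚ.- w) ℚ.+ (x ℚ.- z) ℚ.* w ∣
      ≤⟨ ℚₚ.∣p+q∣≤∣p∣+∣q∣ (x ℚ.* (y ℚ.- w)) ((x ℚ.- z) ℚ.* w) ⟩
    ℚ.∣ x ℚ.* (y ℚ.- w) ∣ ℚ.+ ℚ.∣ (x ℚ.- z) ℚ.* w ∣
      ≤⟨ ℚₚ.+-mono-≤ (*-mono-∣∣ {x} {y ℚ.- w} x≤A yw≤δ) (*-mono-∣∣ {x ℚ.- z} {w} xz≤δ w≤B) ⟩
    A ℚ.* δ ℚ.+ δ ℚ.* B
      ≡⟨ cong (ℚ._+ δ ℚ.* B) (ℚₚ.*-comm A δ) ⟩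
    δ ℚ.* A ℚ.+ δ ℚ.* B
      ≡⟨ ℚₚ.*-distribˡ-+ δ A B ⟨
    δ ℚ.* (A ℚ.+ B) ∎
    where open ℚₚ.≤-Reasoning

  quotient : ∀ ε C → 0ℚ ℚ.< ε → ℚ.Positive C → ∃[ δ ] 0ℚ ℚ.< δ × δ ℚ.* C ≡ ε
  quotient ε C 0<ε C>0 = ε ℚ.* C⁻¹
    , ℚₚ.positive⁻¹ _ {{ℚₚ.pos*pos⇒pos ε {{ℚ.positive 0<ε}} C⁻¹ {{ℚₚ.1/pos⇒pos C {{C>0}}}}}}
    , trans (ℚₚ.*-assoc ε C⁻¹ C)
        (trans (cong (ε ℚ.*_) (ℚₚ.*-inverseˡ C {{C≢0}})) (ℚₚ.*-identityʳ ε))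
    where
    C≢0 = ℚₚ.pos⇒nonZero C {{C>0}}
    C⁻¹ = ℚ.1/_ C {{C≢0}}

  *-cauchy : ∀ {a b} → IsCauchy a → IsCauchy b → IsCauchy (λ n → a n ℚ.* b n)
  *-cauchy {a} {b} ca cb ε 0<ε =
    let A , A>0 , Nᵃ , ∣a∣≤A = cauchy⇒bounded {a} ca
        B , B>0 , Nᵇ , ∣b∣≤B = cauchy⇒bounded {b} cb
        δ , 0<δ , δC≡ε = quotient ε (A ℚ.+ B) 0<ε (ℚₚ.pos+pos⇒pos A {{A>0}} B {{B>0}})
        N₁ , h₁ = ca δ 0<δ
        N₂ , h₂ = cb δ 0<δ
        M = Nᵃ ⊔ Nᵇ
        N = N₁ ⊔ N₂
    in M ⊔ N , λ m n K≤m K≤n →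
      let M≤m = ℕₚ.m⊔n≤o⇒m≤o M N K≤m
          N≤m = ℕₚ.m⊔n≤o⇒n≤o M N K≤m
          M≤n = ℕₚ.m⊔n≤o⇒m≤o M N K≤n
          N≤n = ℕₚ.m⊔n≤o⇒n≤o M N K≤n
      in subst (ℚ.∣ a m ℚ.* b m ℚ.- a n ℚ.* b n ∣ ℚ.≤_) δC≡ε
        (*-close (a m) (b m) (a n) (b n)
          (∣a∣≤A m (ℕₚ.m⊔n≤o⇒m≤o Nᵃ Nᵇ M≤m)) (∣b∣≤B n (ℕₚ.m⊔n≤o⇒n≤o Nᵃ Nᵇ M≤n))
          (h₁ m n (ℕₚ.m⊔n≤o⇒m≤o N₁ N₂ N≤m) (ℕₚ.m⊔n≤o⇒m≤o N₁ N₂ N≤n))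
          (h₂ m n (ℕₚ.m⊔n≤o⇒n≤o N₁ N₂ N≤m) (ℕₚ.m⊔n≤o⇒n≤o N₁ N₂ N≤n)))

_+_ _*_ : ℝ → ℝ → ℝ
x + y = mkℝ (λ n → seq x n ℚ.+ seq y n) (+-cauchy {seq x} {seq y} (cauchy x) (cauchy y))
x * y = mkℝ (λ n → seq x n ℚ.* seq y n) (*-cauchy {seq x} {seq y} (cauchy x) (cauchy y))

-_ : ℝ → ℝ
- x = mkℝ (λ n → ℚ.- seq x n) (neg-cauchy {seq x} (cauchy x))

_-_ : ℝ → ℝ → ℝ
x - y = x + (- y)

-- f = o(1/n).  The condition - ε/n ≤ f n ≤ ε/n says |f n| ≤ ε · (1/n).
_=o[1/n] : (ℕ → ℝ) → Set
f =o[1/n] = ∀ ε → 0ℝ < ε → Eventually λ n → .{{_ : ℕ.NonZero n}} →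
  - (ε * fromℚ (+ 1 ℚ./ n)) ≤ f n × f n ≤ ε * fromℚ (+ 1 ℚ./ n)

------------------------------------------------------------------------
-- Euclidean space

Point : ℕ → Set
Point d = Fin d → ℝ

_≋_ : ∀ {d} → Point d → Point d → Set
x ≋ y = ∀ c → x c ≃ y c

-- IsDist x y r says r = |x − y|, that is, r is the nonnegative square
-- root of the sum of the squares of the coordinates of x − y.
IsDist : ∀ {d} → Point d → Point d → ℝ → Set
IsDist x y r =
  0ℝ ≤ r × r * r ≃ Vector.foldr _+_ 0ℝ (λ c → (x c - y c) * (x c - y c))

-- IsDiam V D says D = max |x − y| over x, y in the finite family V.
IsDiam : ∀ {d m} → (Fin m → Point d) → ℝ → Set
IsDiam V D =
  (∃[ i ] ∃[ j ] IsDist (V i) (V j) D) ×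
  (∀ i j r → IsDist (V i) (V j) r → r ≤ D)

------------------------------------------------------------------------
-- Simple graphs

record Graph : Set₁ where
  field
    Vertex : Set
    _~_    : Vertex → Vertex → Set
    ~-sym    : ∀ {u v} → u ~ v → v ~ u
    ~-irrefl : ∀ {v} → ¬ (v ~ v)

_≅_ : Graph → Graph → Set
G ≅ H = Σ[ φ ∈ (G.Vertex ↔ H.Vertex) ]
  ∀ u v → (u G.~ v) ⇔ (Inverse.to φ u H.~ Inverse.to φ v)
  where
  module G = Graph G
  module H = Graph H

Colourable : ℕ → Graph → Set
Colourable m G = Σ[ c ∈ (Vertex → Fin m) ] ∀ u v → u ~ v → c u ≢ c v
  where open Graph G

-- χ[ G ]≡ m says that the chromatic number of G is m.
χ[_]≡_ : Graph → ℕ → Set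
χ[ G ]≡ m = Colourable m G × (∀ j → Colourable j G → m ℕ.≤ j)

Connected : Graph → Set
Connected G = ∀ u v → Star _~_ u v
  where open Graph G

private
  IsDist-sym : ∀ {d} (x y : Point d) {r} → IsDist x y r → IsDist y x r
  IsDist-sym {d} x y {r} (0≤r , r²≃) = 0≤r , λ ε 0<ε →
    let N , h = r²≃ ε 0<ε in
    N , λ n N≤n → subst (λ s → ℚ.∣ seq (r * r) n ℚ.- s ∣ ℚ.≤ ε) (go d x y n) (h n N≤n)
    where
    go : ∀ d (x y : Point d) n →
         seq (Vector.foldr _+_ 0ℝ (λ c → (x c - y c) * (x c - y c))) n ≡
         seq (Vector.foldr _+_ 0ℝ (λ c → (y c - x c) * (y c - x c))) n
    go zero    x y n = refl
    go (suc d) x y n = cong₂ ℚ._+_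
      (solve 2 (λ a b → (a :- b) :* (a :- b) := (b :- a) :* (b :- a))
             refl (seq (x zero) n) (seq (y zero) n))
      (go d (λ c → x (suc c)) (λ c → y (suc c)) n)

-- The vertices are the indices of the points of V, which is to be an
-- injective enumeration.  The clause i ≢ j excludes a loop when V is a
-- single point, where diam V = 0.
diameterGraph : ∀ {d m} → (Fin m → Point d) → Graph
diameterGraph {m = m} V = record
  { Vertex   = Fin m
  ; _~_      = λ i j → i ≢ j × ∃[ D ] (IsDiam V D × IsDist (V i) (V j) D)
  ; ~-sym    = λ {i} {j} (i≢j , D , diam , dist) →
                 (λ j≡i → i≢j (sym j≡i)) , D , diam , IsDist-sym (V i) (V j) {D} dist
  ; ~-irrefl = λ (i≢i , _) → i≢i refl
  }

IsDiameterGraph : ℕ → Graph → Set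
IsDiameterGraph d G =
  ∃[ m ] Σ[ V ∈ (Fin m → Point d) ] Injective _≡_ _≋_ V × G ≅ diameterGraph V

------------------------------------------------------------------------
-- The random graph G(n,p)

-- A labelled simple graph on Fin n.  In g ▹ r, the new vertex is zero,
-- the old vertices are shifted by suc, and r lists the adjacencies
-- between the new vertex and the old ones.
data LGraph : ℕ → Set where
  ∅   : LGraph 0
  _▹_ : ∀ {n} → LGraph n → Vec Bool n → LGraph (suc n)

adjacent : ∀ {n} → LGraph n → Fin n → Fin n → Bool
adjacent (g ▹ r) zero    zero    = false
adjacent (g ▹ r) zero    (suc j) = lookup r j
adjacent (g ▹ r) (suc i) zero    = lookup r i
adjacent (g ▹ r) (suc i) (suc j) = adjacent g i j

private
  adjacent-sym : ∀ {n} (g : LGraph n) i j → adjacent g i j ≡ adjacent g j i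
  adjacent-sym (g ▹ r) zero    zero    = refl
  adjacent-sym (g ▹ r) zero    (suc j) = refl
  adjacent-sym (g ▹ r) (suc i) zero    = refl
  adjacent-sym (g ▹ r) (suc i) (suc j) = adjacent-sym g i j

  adjacent-irrefl : ∀ {n} (g : LGraph n) i → ¬ (adjacent g i i ≡ true)
  adjacent-irrefl (g ▹ r) zero    ()
  adjacent-irrefl (g ▹ r) (suc i) = adjacent-irrefl g i

infix 20 _[_]

_[_] : ∀ {n} → LGraph n → Subset n → Graph
_[_] {n} g W = record
  { Vertex   = Σ[ i ∈ Fin n ] i ∈ W
  ; _~_      = λ (i , _) (j , _) → adjacent g i j ≡ true
  ; ~-sym    = λ {(i , _)} {(j , _)} i~j → trans (adjacent-sym g j i) i~j
  ; ~-irrefl = λ {(i , _)} → adjacent-irrefl g i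
  }

allRows : ∀ n → List (Vec Bool n)
allRows zero    = [] ∷ []
allRows (suc n) = cartesianProductWith _∷_ (true ∷ false ∷ []) (allRows n)

allLGraphs : ∀ n → List (LGraph n)
allLGraphs zero    = ∅ ∷ []
allLGraphs (suc n) = cartesianProductWith _▹_ (allLGraphs n) (allRows n)

rowWeight : ∀ {n} → ℝ → Vec Bool n → ℝ
rowWeight p []      = 1ℝ
rowWeight p (b ∷ r) = (if b then p else 1ℝ - p) * rowWeight p r

weight : ∀ {n} → ℝ → LGraph n → ℝ
weight p ∅       = 1ℝ
weight p (g ▹ r) = weight p g * rowWeight p r

ℙ : ∀ n → ℝ → {A : Pred (LGraph n) 0ℓ} → Decidable A → ℝ
ℙ n p A? = foldr _+_ 0ℝ (map (weight p) (filter A? (allLGraphs n)))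

-- ℙ n p A? does not depend on the choice of A?, which merely selects the
-- graphs to be summed over.  Since the sample space is finite,
-- ¬ ¬ Decidable A always holds, so ¬ (A With-Probability>½ p) is never
-- true merely for want of a decision procedure.
_With-Probability>½_ : ∀ {n} → Pred (LGraph n) 0ℓ → ℝ → Set
_With-Probability>½_ {n} A p = Σ[ A? ∈ Decidable A ] ½ℝ < ℙ n p A?

------------------------------------------------------------------------
-- u_d(n,p) and u_d'(n,p)

IsLargestPositiveOr0 : (ℕ → Set) → ℕ → Set
IsLargestPositiveOr0 Q k =
  (1 ℕ.≤ k × Q k × (∀ j → 1 ℕ.≤ j → Q j → j ℕ.≤ k)) ⊎
  (k ≡ 0 × (∀ j → 1 ℕ.≤ j → ¬ Q j))

HasInduced : (Graph → Set) → ∀ {n} → ℕ → Pred (LGraph n) 0ℓ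
HasInduced P {n} k g = Σ[ W ∈ Subset n ] ∣ W ∣ ≡ k × P (g [ W ])

u[_,_,_]≡_ : ℕ → ℕ → ℝ → ℕ → Set
u[ d , n , p ]≡ u = IsLargestPositiveOr0
  (λ k → HasInduced (λ G → IsDiameterGraph d G × χ[ G ]≡ suc d) {n} k With-Probability>½ p) u

u′[_,_,_]≡_ : ℕ → ℕ → ℝ → ℕ → Set
u′[ d , n , p ]≡ u = IsLargestPositiveOr0
  (λ k → HasInduced (λ G → IsDiameterGraph d G × χ[ G ]≡ suc d × Connected G) {n} k
           With-Probability>½ p) u

{-# OPTIONS --safe #-}

-- A graph with an induced subgraph of chromatic number 3 contains a cycle,
-- so it suffices that for qn ≤ 1/2 a cycle occurs with probability at most
-- 1/4.  Exposing the edges at x last gives ℙ(x and y are linked) ≤ 2q for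
-- x ≢ y, by induction on n.  When the vertices are added one by one, the
-- cycle closed by a new vertex needs two neighbours that are already linked,
-- which has probability at most n² · q² · 2q ≤ q/2; these sum to at most qn/2.
--
-- As p is a Cauchy sequence, the estimate is made for its rational terms q.
-- These may be negative, but only slightly so, and there the polynomial
-- 𝔼 q differs little from 𝔼 0.

module Submission where

open import Defs
open import Data.Bool.Base using (Bool; true; false; not; if_then_else_)
open import Data.Bool.Properties as 𝔹ₚ using (not-injective)
open import Data.Empty using (⊥)
open import Data.Fin.Base using (Fin; zero; suc; punchIn; punchOut)
open import Data.Fin.Properties as Finₚ using (any?; punchIn-punchOut; punchInᵢ≢i)
open import Data.Fin.Subset using (⊤)
open import Data.Fin.Subset.Properties using (∈⊤)
import Data.Integer.Base as ℤ
import Data.Integer.Properties as ℤₚ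
open import Data.List.Base using (List; []; _∷_; map; foldr; filter; cartesianProductWith; _++_)
open import Data.Nat.Base as ℕ using (ℕ; zero; suc; _⊔_)
import Data.Nat.Properties as ℕₚ
open import Data.Product.Base using (_×_; _,_; proj₁; proj₂; ∃; ∃-syntax)
open import Data.Rational.Base as ℚ using (ℚ; 0ℚ; 1ℚ; ½)
import Data.Rational.Properties as ℚₚ
open import Data.Rational.Solver using (module +-*-Solver)
import Data.Rational.Unnormalised.Base as ℚᵘ
import Data.Rational.Unnormalised.Properties as ℚᵘₚ
open import Data.Sum.Base using (_⊎_; inj₁; inj₂; [_,_]′)
open import Data.Vec.Base using (Vec; []; _∷_; lookup; insertAt)
open import Data.Vec.Properties using (insertAt-lookup; insertAt-punchIn)
open import Function.Base using (_∘_; id)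
open import Level using (0ℓ)
open import Relation.Binary.Construct.Closure.ReflexiveTransitive
  using (Star; ε; _◅_; _◅◅_; gmap; reverse; return)
open import Relation.Binary.PropositionalEquality
  using (_≡_; _≢_; refl; sym; trans; cong; cong₂; subst; module ≡-Reasoning)
open import Relation.Nullary using (¬_; Dec; yes; no; does; contradiction)
open import Relation.Nullary.Decidable using (map′; _×-dec_; _⊎-dec_; ¬?)
open import Relation.Unary using (Pred; Decidable)
open import Relation.Unary.Properties using (U?)

private variable
  A B : Set
  m n : ℕ

-- Linked vertices

Adjacent : LGraph n → Fin n → Fin n → Set
Adjacent g i j = adjacent g i j ≡ true

Linked : LGraph n → Fin n → Fin n → Set
Linked g = Star (Adjacent g)

Adjacent-sym : (g : LGraph n) {i j : Fin n} → Adjacent g i j → Adjacent g j i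
Adjacent-sym g {i} {j} = Graph.~-sym (g [ ⊤ ]) {i , ∈⊤} {j , ∈⊤}

Linked-sym : (g : LGraph n) {i j : Fin n} → Linked g i j → Linked g j i
Linked-sym g = reverse (Adjacent-sym g)

-- Cutting a path at its last visit to a yields the second alternative.
avoid-or-leave : {R : A → A → Set} {S : B → B → Set} {a : A} (f : B → A) →
  (∀ v → v ≡ a ⊎ ∃[ b ] v ≡ f b) → (∀ {b c} → f b ≡ f c → b ≡ c) →
  (∀ {b c} → R (f b) (f c) → S b c) →
  ∀ {v y} → Star R v (f y) →
  (∃[ x ] v ≡ f x × Star S x y) ⊎ (∃[ z ] R a (f z) × Star S z y)
avoid-or-leave f view inj R⇒S {y = y} ε = inj₁ (y , refl , ε)
avoid-or-leave {R = R} f view inj R⇒S {v} (v~w ◅ p)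
  with avoid-or-leave f view inj R⇒S p
... | inj₂ leave = inj₂ leave
... | inj₁ (x , refl , q) with view v
...   | inj₁ refl       = inj₂ (x , v~w , q)
...   | inj₂ (b , refl) = inj₁ (b , refl , R⇒S v~w ◅ q)

-- `_▹_` only adds the vertex `zero`. Insertion at any position lets an arbitrary vertex play the
-- part of the newest one, so that the edges at it can be exposed last.
insert : LGraph n → Fin (suc n) → Vec Bool n → LGraph (suc n)
insert g       zero    r       = g ▹ r
insert (g ▹ s) (suc x) (b ∷ r) = insert g x r ▹ insertAt s x b

adjacent-insert-punchIn : ∀ (g : LGraph n) x r i j →
  adjacent (insert g x r) (punchIn x i) (punchIn x j) ≡ adjacent g i j
adjacent-insert-punchIn g       zero    r       i       j       = refl
adjacent-insert-punchIn (g ▹ s) (suc x) (b ∷ r) zero    zero    = refl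
adjacent-insert-punchIn (g ▹ s) (suc x) (b ∷ r) zero    (suc j) = insertAt-punchIn s x b j
adjacent-insert-punchIn (g ▹ s) (suc x) (b ∷ r) (suc i) zero    = insertAt-punchIn s x b i
adjacent-insert-punchIn (g ▹ s) (suc x) (b ∷ r) (suc i) (suc j) =
  adjacent-insert-punchIn g x r i j

adjacent-insert : ∀ (g : LGraph n) x r j →
  adjacent (insert g x r) x (punchIn x j) ≡ lookup r j
adjacent-insert g       zero    r       j       = refl
adjacent-insert (g ▹ s) (suc x) (b ∷ r) zero    = insertAt-lookup s x b
adjacent-insert (g ▹ s) (suc x) (b ∷ r) (suc j) = adjacent-insert g x r j

punchIn-view : ∀ (x v : Fin (suc n)) → v ≡ x ⊎ ∃[ i ] v ≡ punchIn x i
punchIn-view x v with x Finₚ.≟ v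
... | yes x≡v = inj₁ (sym x≡v)
... | no  x≢v = inj₂ (punchOut x≢v , sym (punchIn-punchOut x≢v))

LeavesTo : LGraph n → Vec Bool n → Fin n → Set
LeavesTo g r y = ∃[ z ] lookup r z ≡ true × Linked g z y

-- After its last visit to `x`, a path to an old vertex stays in `g`; if it never visits `x`, it
-- lies in `g` altogether.
Linked-insert⁻ : ∀ (g : LGraph n) x r {v y} → Linked (insert g x r) v (punchIn x y) →
  (∃[ u ] v ≡ punchIn x u × Linked g u y) ⊎ LeavesTo g r y
Linked-insert⁻ g x r p
  with avoid-or-leave (punchIn x) (punchIn-view x) (Finₚ.punchIn-injective x _ _)
         (λ {i} {j} → trans (sym (adjacent-insert-punchIn g x r i j))) p
... | inj₁ q               = inj₁ q
... | inj₂ (z , x~z , q) = inj₂ (z , trans (sym (adjacent-insert g x r z)) x~z , q)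

Linked-insert⇒LeavesTo : ∀ (g : LGraph n) x r {y} →
  Linked (insert g x r) x (punchIn x y) → LeavesTo g r y
Linked-insert⇒LeavesTo g x r p with Linked-insert⁻ g x r p
... | inj₂ leaves          = leaves
... | inj₁ (u , x≡ , _) = contradiction (sym x≡) (punchInᵢ≢i x u)

-- The preceding dichotomy is applied to the path and to its reversal: if neither yields a link in
-- `g`, both ends are reached from the new vertex.
Linked-old⁻ : ∀ (g : LGraph n) r {x y} → Linked (g ▹ r) (suc x) (suc y) →
  Linked g x y ⊎ LeavesTo g r x × LeavesTo g r y
Linked-old⁻ g r p
  with Linked-insert⁻ g zero r p | Linked-insert⁻ g zero r (Linked-sym (g ▹ r) p)
... | inj₁ (_ , refl , q) | _                   = inj₁ q
... | inj₂ _              | inj₁ (_ , refl , q) = inj₁ (Linked-sym g q)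
... | inj₂ leavesY        | inj₂ leavesX        = inj₂ (leavesX , leavesY)

Linked-old⁺ : ∀ (g : LGraph n) r {x y} → Linked g x y → Linked (g ▹ r) (suc x) (suc y)
Linked-old⁺ g r = gmap suc id

LeavesTo⇒Linked : ∀ (g : LGraph n) r {y} → LeavesTo g r y → Linked (g ▹ r) zero (suc y)
LeavesTo⇒Linked g r (z , rz , q) = rz ◅ Linked-old⁺ g r q

-- Links have to be decidable before `𝟙` can turn them into random variables. The recursion removes
-- the newest vertex: two old vertices are linked either without it or because both are reached from
-- it.
linked? : ∀ (g : LGraph n) x y → Dec (Linked g x y)
leavesTo? : ∀ (g : LGraph n) r y → Dec (LeavesTo g r y)

leavesTo? g r y = any? λ z → (lookup r z 𝔹ₚ.≟ true) ×-dec linked? g z y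

linked? (g ▹ r) zero    zero    = yes ε
linked? (g ▹ r) zero    (suc y) =
  map′ (LeavesTo⇒Linked g r) (Linked-insert⇒LeavesTo g zero r) (leavesTo? g r y)
linked? (g ▹ r) (suc x) zero    =
  map′ (Linked-sym (g ▹ r) ∘ LeavesTo⇒Linked g r)
       (Linked-insert⇒LeavesTo g zero r ∘ Linked-sym (g ▹ r)) (leavesTo? g r x)
linked? (g ▹ r) (suc x) (suc y) =
  map′ [ Linked-old⁺ g r
       , (λ (lx , ly) → Linked-sym (g ▹ r) (LeavesTo⇒Linked g r lx) ◅◅ LeavesTo⇒Linked g r ly) ]′
       (Linked-old⁻ g r)
       (linked? g x y ⊎-dec (leavesTo? g r x ×-dec leavesTo? g r y))

-- Cycles and two-colourings

ClosesCycle : LGraph n → Vec Bool n → Fin n → Fin n → Set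
ClosesCycle g r z w = z ≢ w × Linked g z w × lookup r z ≡ true × lookup r w ≡ true

closesCycle? : ∀ (g : LGraph n) r z w → Dec (ClosesCycle g r z w)
closesCycle? g r z w =
  ¬? (z Finₚ.≟ w) ×-dec linked? g z w ×-dec (lookup r z 𝔹ₚ.≟ true) ×-dec (lookup r w 𝔹ₚ.≟ true)

-- A cycle is noticed when its last vertex is added: the rest of it is then a path in the old graph
-- between two distinct neighbours of the new vertex.
Cyclic : LGraph n → Set
Cyclic ∅       = ⊥
Cyclic (g ▹ r) = Cyclic g ⊎ ∃[ z ] ∃[ w ] ClosesCycle g r z w

cyclic? : (g : LGraph n) → Dec (Cyclic g)
cyclic? ∅       = no λ ()
cyclic? (g ▹ r) = cyclic? g ⊎-dec any? λ z → any? λ w → closesCycle? g r z w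

Proper : LGraph n → (Fin n → Bool) → Set
Proper g c = ∀ i j → Adjacent g i j → c i ≢ c j

-- The new vertex gets false; every component it meets is recoloured so
-- that the one neighbour in that component gets true.
acyclic⇒2-colouring : (g : LGraph n) → ¬ Cyclic g → ∃ (Proper g)
acyclic⇒2-colouring ∅       _ = (λ ()) , λ ()
acyclic⇒2-colouring {suc n} (g ▹ r) acyclic = c′ , proper′
  where
  ih = acyclic⇒2-colouring g (acyclic ∘ inj₁)
  c = proj₁ ih

  recolour : ∀ i → Dec (LeavesTo g r i) → Bool
  recolour i (yes (z , _)) = if c z then c i else not (c i)
  recolour i (no _)        = c i

  c′ : Fin (suc n) → Bool
  c′ zero    = false
  c′ (suc i) = recolour i (leavesTo? g r i)

  -- Two neighbours of the new vertex in one component of `g` would close a cycle.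
  unique : ∀ {z w} → lookup r z ≡ true → lookup r w ≡ true → Linked g z w → z ≡ w
  unique {z} {w} rz rw l with z Finₚ.≟ w
  ... | yes z≡w = z≡w
  ... | no  z≢w = contradiction (inj₂ (z , w , z≢w , l , rz , rw)) acyclic

  recolour-proper : ∀ i j → Adjacent g i j →
    (di : Dec (LeavesTo g r i)) (dj : Dec (LeavesTo g r j)) →
    recolour i di ≢ recolour j dj
  recolour-proper i j i~j (no _)  (no _)  = proj₂ ih i j i~j
  -- Adjacent vertices share a component, so the new vertex reaches both or neither.
  recolour-proper i j i~j (no ¬l) (yes (z , rz , l)) =
    contradiction (z , rz , l ◅◅ return (Adjacent-sym g i~j)) ¬l
  recolour-proper i j i~j (yes (z , rz , l)) (no ¬l) =
    contradiction (z , rz , l ◅◅ return i~j) ¬l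
  -- By uniqueness the same neighbour governs both ends, so both keep their colours or both are
  -- flipped.
  recolour-proper i j i~j (yes (z , rz , l)) (yes (w , rw , k))
    with refl ← unique rz rw (l ◅◅ i~j ◅ Linked-sym g k) with c z
  ... | true  = proj₂ ih i j i~j
  ... | false = proj₂ ih i j i~j ∘ not-injective

  neighbour-true : ∀ j → lookup r j ≡ true → (d : Dec (LeavesTo g r j)) → recolour j d ≡ true
  neighbour-true j rj (no ¬l) = contradiction (j , rj , ε) ¬l
  neighbour-true j rj (yes (z , rz , l)) with refl ← unique rz rj l with c j
  ... | true  = refl
  ... | false = refl

  proper′ : Proper (g ▹ r) c′
  proper′ zero    (suc j) rj eq with () ← trans eq (neighbour-true j rj (leavesTo? g r j))
  proper′ (suc i) zero    ri eq with () ← trans (sym eq) (neighbour-true i ri (leavesTo? g r i))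
  proper′ (suc i) (suc j) i~j = recolour-proper i j i~j (leavesTo? g r i) (leavesTo? g r j)

toFin2 : Bool → Fin 2
toFin2 false = zero
toFin2 true  = suc zero

toFin2-injective : ∀ {a b} → toFin2 a ≡ toFin2 b → a ≡ b
toFin2-injective {false} {false} _ = refl
toFin2-injective {true}  {true}  _ = refl

-- A proper colouring of the whole graph restricts to every induced subgraph.
¬2-colourable⇒cyclic : ∀ (g : LGraph n) W → ¬ Colourable 2 (g [ W ]) → Cyclic g
¬2-colourable⇒cyclic g W ¬col with cyclic? g
... | yes cyclic = cyclic
... | no acyclic with acyclic⇒2-colouring g acyclic
...   | c , proper = contradiction
  ((λ (i , _) → toFin2 (c i)) , λ (i , _) (j , _) i~j → proper i j i~j ∘ toFin2-injective) ¬col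

χ≡3⇒cyclic : ∀ (g : LGraph n) W → χ[ g [ W ] ]≡ 3 → Cyclic g
χ≡3⇒cyclic g W (_ , minimal) =
  ¬2-colourable⇒cyclic g W λ col → contradiction (minimal 2 col) (ℕₚ.<⇒≱ ℕₚ.≤-refl)

-- Rational arithmetic

open +-*-Solver using (solve; con; _:+_; _:*_; _:-_; :-_; _:=_)

¼ : ℚ
¼ = ½ ℚ.* ½

0≤1 : 0ℚ ℚ.≤ 1ℚ
0≤1 = ℚₚ.nonNegative⁻¹ 1ℚ

*-mono-≤ˡ : ∀ {r} p {q} → 0ℚ ℚ.≤ r → p ℚ.≤ q → r ℚ.* p ℚ.≤ r ℚ.* q
*-mono-≤ˡ {r} p 0≤r = ℚₚ.*-monoˡ-≤-nonNeg r {{ℚ.nonNegative 0≤r}} {p}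

*-mono-≤ʳ : ∀ {r} p {q} → 0ℚ ℚ.≤ r → p ℚ.≤ q → p ℚ.* r ℚ.≤ q ℚ.* r
*-mono-≤ʳ {r} p 0≤r = ℚₚ.*-monoʳ-≤-nonNeg r {{ℚ.nonNegative 0≤r}} {p}

0≤+ : ∀ {p q} → 0ℚ ℚ.≤ p → 0ℚ ℚ.≤ q → 0ℚ ℚ.≤ p ℚ.+ q
0≤+ = ℚₚ.+-mono-≤

0≤* : ∀ {p q} → 0ℚ ℚ.≤ p → 0ℚ ℚ.≤ q → 0ℚ ℚ.≤ p ℚ.* q
0≤* {p} {q} 0≤p 0≤q = subst (ℚ._≤ p ℚ.* q) (ℚₚ.*-zeroʳ p) (*-mono-≤ˡ 0ℚ 0≤p 0≤q)

p≤∣p∣ : ∀ p → p ℚ.≤ ℚ.∣ p ∣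
p≤∣p∣ p with ℚₚ.≤-total 0ℚ p
... | inj₁ 0≤p = ℚₚ.≤-reflexive (sym (ℚₚ.0≤p⇒∣p∣≡p 0≤p))
... | inj₂ p≤0 = ℚₚ.≤-trans p≤0 (ℚₚ.0≤∣p∣ p)

-- The embedding of ℕ in ℚ, by recursion so that inductions on `n` and the ring solver meet
-- `ι (suc n)` as `1ℚ ℚ.+ ι n`.
ι : ℕ → ℚ
ι zero    = 0ℚ
ι (suc n) = 1ℚ ℚ.+ ι n

0≤ι : ∀ n → 0ℚ ℚ.≤ ι n
0≤ι zero    = ℚₚ.≤-refl
0≤ι (suc n) = 0≤+ 0≤1 (0≤ι n)

toℚᵘ-ι : ∀ n → ℚ.toℚᵘ (ι n) ℚᵘ.≃ ℚᵘ.mkℚᵘ (ℤ.+ n) 0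
toℚᵘ-ι zero    = ℚᵘₚ.≃-refl
toℚᵘ-ι (suc n) = ℚᵘₚ.≃-trans (ℚₚ.toℚᵘ-homo-+ 1ℚ (ι n))
  (ℚᵘₚ.≃-trans (ℚᵘₚ.+-congʳ (ℚ.toℚᵘ 1ℚ) (toℚᵘ-ι n))
    (ℚᵘ.*≡* (cong (λ i → (ℤ.+ 1 ℤ.+ i) ℤ.* ℤ.+ 1) (ℤₚ.*-identityʳ (ℤ.+ n)))))

-- This ties `ι n` to the fraction in `_=o[1/n]`. It is checked on unnormalised fractions, which
-- multiply without cancellation.
1/n*ι : ∀ n .{{_ : ℕ.NonZero n}} → (ℤ.+ 1 ℚ./ n) ℚ.* ι n ≡ 1ℚ
1/n*ι n@(suc m) = ℚₚ.toℚᵘ-injective (ℚᵘₚ.≃-trans (ℚₚ.toℚᵘ-homo-* (ℤ.+ 1 ℚ./ n) (ι n))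
  (ℚᵘₚ.≃-trans (ℚᵘₚ.*-cong (ℚₚ.toℚᵘ-fromℚᵘ (ℚᵘ.mkℚᵘ (ℤ.+ 1) m)) (toℚᵘ-ι n))
    (ℚᵘₚ.*-inverseˡ (ℚᵘ.mkℚᵘ (ℤ.+ n) 0))))

-- Random graphs as sequences of coin tosses

-- The bias of the coin is left open: the same tree can be evaluated at different `q`, as the
-- comparison with 0 requires. Independent experiments are composed by grafting trees.
data Trial (A : Set) : Set where
  result : A → Trial A
  toss   : Trial A → Trial A → Trial A

_>>=_ : Trial A → (A → Trial B) → Trial B
result a >>= k = k a
toss t s >>= k = toss (t >>= k) (s >>= k)

_⊗_ : Trial A → Trial B → Trial (A × B)
t ⊗ s = t >>= λ a → s >>= λ b → result (a , b)

coin : Trial Bool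
coin = toss (result true) (result false)

rows : ∀ n → Trial (Vec Bool n)
rows zero    = result []
rows (suc n) = coin >>= λ b → rows n >>= λ r → result (b ∷ r)

graphs : ∀ n → Trial (LGraph n)
graphs zero    = result ∅
graphs (suc n) = graphs n >>= λ g → rows n >>= λ r → result (g ▹ r)

-- For q outside [0, 1] this is a polynomial in q without probabilistic meaning.
𝔼 : ℚ → Trial A → (A → ℚ) → ℚ
𝔼 q (result a) f = f a
𝔼 q (toss t s) f = q ℚ.* 𝔼 q t f ℚ.+ (1ℚ ℚ.- q) ℚ.* 𝔼 q s f

𝟙 : Dec A → ℚ
𝟙 d = if does d then 1ℚ else 0ℚ

ℙr : ∀ q → Trial A → {P : Pred A 0ℓ} → Decidable P → ℚ
ℙr q t P? = 𝔼 q t (λ a → 𝟙 (P? a))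

0≤𝟙 : (d : Dec A) → 0ℚ ℚ.≤ 𝟙 d
0≤𝟙 (yes _) = 0≤1
0≤𝟙 (no _)  = ℚₚ.≤-refl

𝟙≤1 : (d : Dec A) → 𝟙 d ℚ.≤ 1ℚ
𝟙≤1 (yes _) = ℚₚ.≤-refl
𝟙≤1 (no _)  = 0≤1

𝟙-mono : (A → B) → (d : Dec A) (e : Dec B) → 𝟙 d ℚ.≤ 𝟙 e
𝟙-mono f (yes a) (yes b) = ℚₚ.≤-refl
𝟙-mono f (yes a) (no ¬b) = contradiction (f a) ¬b
𝟙-mono f (no _)  e       = 0≤𝟙 e

𝟙-⊎ : (d : Dec A) (e : Dec B) → 𝟙 (d ⊎-dec e) ℚ.≤ 𝟙 d ℚ.+ 𝟙 e
𝟙-⊎ (yes _) e = subst (ℚ._≤ 1ℚ ℚ.+ 𝟙 e) (ℚₚ.+-identityʳ 1ℚ) (ℚₚ.+-monoʳ-≤ 1ℚ (0≤𝟙 e))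
𝟙-⊎ (no _)  e = ℚₚ.≤-reflexive (sym (ℚₚ.+-identityˡ (𝟙 e)))

𝟙-× : (d : Dec A) (e : Dec B) → 𝟙 (d ×-dec e) ≡ 𝟙 d ℚ.* 𝟙 e
𝟙-× (yes _) e = sym (ℚₚ.*-identityˡ (𝟙 e))
𝟙-× (no _)  e = sym (ℚₚ.*-zeroˡ (𝟙 e))

-- Linearity, independence and exchangeability

module _ (q : ℚ) where

  𝔼-cong : ∀ (t : Trial A) {f g : A → ℚ} → (∀ a → f a ≡ g a) → 𝔼 q t f ≡ 𝔼 q t g
  𝔼-cong (result a) f≡g = f≡g a
  𝔼-cong (toss t s) f≡g =
    cong₂ (λ x y → q ℚ.* x ℚ.+ (1ℚ ℚ.- q) ℚ.* y) (𝔼-cong t f≡g) (𝔼-cong s f≡g)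

  𝔼->>= : ∀ (t : Trial A) (k : A → Trial B) f →
    𝔼 q (t >>= k) f ≡ 𝔼 q t (λ a → 𝔼 q (k a) f)
  𝔼->>= (result a) k f = refl
  𝔼->>= (toss t s) k f =
    cong₂ (λ x y → q ℚ.* x ℚ.+ (1ℚ ℚ.- q) ℚ.* y) (𝔼->>= t k f) (𝔼->>= s k f)

  𝔼-⊗ : ∀ (t : Trial A) (s : Trial B) f →
    𝔼 q (t ⊗ s) f ≡ 𝔼 q t (λ a → 𝔼 q s (λ b → f (a , b)))
  𝔼-⊗ t s f = trans (𝔼->>= t _ f) (𝔼-cong t λ a → 𝔼->>= s _ f)

  𝔼-const : ∀ (t : Trial A) c → 𝔼 q t (λ _ → c) ≡ c
  𝔼-const (result a) c = refl
  𝔼-const (toss t s) c rewrite 𝔼-const t c | 𝔼-const s c =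
    solve 2 (λ q c → q :* c :+ (con 1ℚ :- q) :* c := c) refl q c

  𝔼-+ : ∀ (t : Trial A) f g → 𝔼 q t (λ a → f a ℚ.+ g a) ≡ 𝔼 q t f ℚ.+ 𝔼 q t g
  𝔼-+ (result a) f g = refl
  𝔼-+ (toss t s) f g rewrite 𝔼-+ t f g | 𝔼-+ s f g =
    solve 5 (λ q x y z w → q :* (x :+ y) :+ (con 1ℚ :- q) :* (z :+ w)
                        := (q :* x :+ (con 1ℚ :- q) :* z) :+ (q :* y :+ (con 1ℚ :- q) :* w))
      refl q (𝔼 q t f) (𝔼 q t g) (𝔼 q s f) (𝔼 q s g)

  𝔼-*ˡ : ∀ (t : Trial A) c f → 𝔼 q t (λ a → c ℚ.* f a) ≡ c ℚ.* 𝔼 q t f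
  𝔼-*ˡ (result a) c f = refl
  𝔼-*ˡ (toss t s) c f rewrite 𝔼-*ˡ t c f | 𝔼-*ˡ s c f =
    solve 4 (λ q c x y → q :* (c :* x) :+ (con 1ℚ :- q) :* (c :* y)
                      := c :* (q :* x :+ (con 1ℚ :- q) :* y))
      refl q c (𝔼 q t f) (𝔼 q s f)

  -- Fubini for finite trees. It rests on linearity alone and so holds for every rational `q`.
  𝔼-swap : ∀ (t : Trial A) (s : Trial B) (f : A → B → ℚ) →
    𝔼 q t (λ a → 𝔼 q s (f a)) ≡ 𝔼 q s (λ b → 𝔼 q t (λ a → f a b))
  𝔼-swap (result a) s f = refl
  𝔼-swap (toss t u) s f
    rewrite 𝔼-+ s (λ b → q ℚ.* 𝔼 q t (λ a → f a b)) (λ b → (1ℚ ℚ.- q) ℚ.* 𝔼 q u (λ a → f a b))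
          | 𝔼-*ˡ s q (λ b → 𝔼 q t (λ a → f a b))
          | 𝔼-*ˡ s (1ℚ ℚ.- q) (λ b → 𝔼 q u (λ a → f a b))
          | 𝔼-swap t s f | 𝔼-swap u s f = refl

  -- The indicator of a conjunction is a product, and each expectation treats the other factor as a
  -- constant.
  ℙr-indep : ∀ (t : Trial A) (s : Trial B) {P Q} (P? : Decidable P) (Q? : Decidable Q) →
    ℙr q (t ⊗ s) (λ (a , b) → P? a ×-dec Q? b) ≡ ℙr q t P? ℚ.* ℙr q s Q?
  ℙr-indep t s P? Q? = begin
    ℙr q (t ⊗ s) (λ (a , b) → P? a ×-dec Q? b)           ≡⟨ 𝔼-⊗ t s _ ⟩
    𝔼 q t (λ a → ℙr q s (λ b → P? a ×-dec Q? b))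
      ≡⟨ 𝔼-cong t (λ a → trans (𝔼-cong s λ b → 𝟙-× (P? a) (Q? b))
           (trans (𝔼-*ˡ s (𝟙 (P? a)) _) (ℚₚ.*-comm (𝟙 (P? a)) _))) ⟩
    𝔼 q t (λ a → ℙr q s Q? ℚ.* 𝟙 (P? a))                 ≡⟨ 𝔼-*ˡ t (ℙr q s Q?) _ ⟩
    ℙr q s Q? ℚ.* ℙr q t P?                              ≡⟨ ℚₚ.*-comm (ℙr q s Q?) _ ⟩
    ℙr q t P? ℚ.* ℙr q s Q?                              ∎
    where open ≡-Reasoning

  𝔼-rows-suc : ∀ n f →
    𝔼 q (rows (suc n)) f ≡ 𝔼 q coin (λ b → 𝔼 q (rows n) (λ r → f (b ∷ r)))
  𝔼-rows-suc n f = trans (𝔼->>= coin (λ b → rows n >>= λ r → result (b ∷ r)) f)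
    (𝔼-cong coin λ b → 𝔼->>= (rows n) (λ r → result (b ∷ r)) f)

  𝔼-graphs-suc : ∀ n f →
    𝔼 q (graphs (suc n)) f ≡ 𝔼 q (graphs n) (λ g → 𝔼 q (rows n) (λ r → f (g ▹ r)))
  𝔼-graphs-suc n f = trans (𝔼->>= (graphs n) (λ g → rows n >>= λ r → result (g ▹ r)) f)
    (𝔼-cong (graphs n) λ g → 𝔼->>= (rows n) (λ r → result (g ▹ r)) f)

  -- The tosses of a row are exchangeable: `𝔼-swap` moves the one at `x` past those before it.
  𝔼-rows-insertAt : ∀ (x : Fin (suc n)) f →
    𝔼 q (rows (suc n)) f ≡ 𝔼 q coin (λ b → 𝔼 q (rows n) (λ r → f (insertAt r x b)))
  𝔼-rows-insertAt {n}     zero    f = 𝔼-rows-suc n f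
  𝔼-rows-insertAt {suc n} (suc x) f = begin
    𝔼 q (rows (suc (suc n))) f
      ≡⟨ 𝔼-rows-suc (suc n) f ⟩
    𝔼 q coin (λ c → 𝔼 q (rows (suc n)) (λ r → f (c ∷ r)))
      ≡⟨ 𝔼-cong coin (λ c → 𝔼-rows-insertAt x (λ r → f (c ∷ r))) ⟩
    𝔼 q coin (λ c → 𝔼 q coin (λ b → 𝔼 q (rows n) (λ r → f (c ∷ insertAt r x b))))
      ≡⟨ 𝔼-swap coin coin (λ c b → 𝔼 q (rows n) (λ r → f (c ∷ insertAt r x b))) ⟩
    𝔼 q coin (λ b → 𝔼 q coin (λ c → 𝔼 q (rows n) (λ r → f (c ∷ insertAt r x b))))
      ≡⟨ 𝔼-cong coin (λ b → 𝔼-rows-suc n (λ r → f (insertAt r (suc x) b))) ⟨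
    𝔼 q coin (λ b → 𝔼 q (rows (suc n)) (λ r → f (insertAt r (suc x) b))) ∎
    where open ≡-Reasoning

  -- The vertices of a random graph are exchangeable: any one of them can
  -- be taken to be the one added last.
  𝔼-graphs-insert : ∀ (x : Fin (suc n)) f →
    𝔼 q (graphs (suc n)) f ≡ 𝔼 q (graphs n) (λ g → 𝔼 q (rows n) (λ r → f (insert g x r)))
  𝔼-graphs-insert {n}     zero    f = 𝔼-graphs-suc n f
  𝔼-graphs-insert {suc n} (suc x) f = begin
    𝔼 q (graphs (suc (suc n))) f
      ≡⟨ 𝔼-graphs-suc (suc n) f ⟩
    𝔼 q (graphs (suc n)) (λ h → 𝔼 q (rows (suc n)) (λ s → f (h ▹ s)))
      ≡⟨ 𝔼-graphs-insert x (λ h → 𝔼 q (rows (suc n)) (λ s → f (h ▹ s))) ⟩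
    𝔼 q (graphs n) (λ g → 𝔼 q (rows n) (λ r → 𝔼 q (rows (suc n)) (λ s → f (insert g x r ▹ s))))
      ≡⟨ 𝔼-cong (graphs n) exchange ⟩
    𝔼 q (graphs n) (λ g → 𝔼 q (rows n) (λ s →
      𝔼 q (rows (suc n)) (λ r → f (insert (g ▹ s) (suc x) r))))
      ≡⟨ 𝔼-graphs-suc n (λ g → 𝔼 q (rows (suc n)) (λ r → f (insert g (suc x) r))) ⟨
    𝔼 q (graphs (suc n)) (λ g → 𝔼 q (rows (suc n)) (λ r → f (insert g (suc x) r))) ∎
    where
    open ≡-Reasoning
    -- The toss `b` for the edge between `zero` and the inserted vertex passes from the row `s` of
    -- the former to the row `r` of the latter.
    exchange : ∀ g →
      𝔼 q (rows n) (λ r → 𝔼 q (rows (suc n)) (λ s → f (insert g x r ▹ s))) ≡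
      𝔼 q (rows n) (λ s → 𝔼 q (rows (suc n)) (λ r → f (insert (g ▹ s) (suc x) r)))
    exchange g = begin
      𝔼 q (rows n) (λ r → 𝔼 q (rows (suc n)) (λ s → f (insert g x r ▹ s)))
        ≡⟨ 𝔼-cong (rows n) (λ r → 𝔼-rows-insertAt x (λ s → f (insert g x r ▹ s))) ⟩
      𝔼 q (rows n) (λ r → 𝔼 q coin (λ b → 𝔼 q (rows n) (λ s → F b r s)))
        ≡⟨ 𝔼-swap (rows n) coin (λ r b → 𝔼 q (rows n) (λ s → F b r s)) ⟩
      𝔼 q coin (λ b → 𝔼 q (rows n) (λ r → 𝔼 q (rows n) (λ s → F b r s)))
        ≡⟨ 𝔼-cong coin (λ b → 𝔼-swap (rows n) (rows n) (F b)) ⟩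
      𝔼 q coin (λ b → 𝔼 q (rows n) (λ s → 𝔼 q (rows n) (λ r → F b r s)))
        ≡⟨ 𝔼-swap (rows n) coin (λ s b → 𝔼 q (rows n) (λ r → F b r s)) ⟨
      𝔼 q (rows n) (λ s → 𝔼 q coin (λ b → 𝔼 q (rows n) (λ r → F b r s)))
        ≡⟨ 𝔼-cong (rows n) (λ s → 𝔼-rows-suc n (λ r → f (insert (g ▹ s) (suc x) r))) ⟨
      𝔼 q (rows n) (λ s → 𝔼 q (rows (suc n)) (λ r → f (insert (g ▹ s) (suc x) r))) ∎
      where
      F : Bool → Vec Bool n → Vec Bool n → ℚ
      F b r s = f (insert g x r ▹ insertAt s x b)

-- Probability bounds for `q` between 0 and 1

module _ {q : ℚ} (0≤q : 0ℚ ℚ.≤ q) (q≤1 : q ℚ.≤ 1ℚ) where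

  open ℚₚ.≤-Reasoning

  𝔼-mono : ∀ (t : Trial A) {f g : A → ℚ} → (∀ a → f a ℚ.≤ g a) → 𝔼 q t f ℚ.≤ 𝔼 q t g
  𝔼-mono (result a) f≤g = f≤g a
  𝔼-mono (toss t s) f≤g = ℚₚ.+-mono-≤
    (*-mono-≤ˡ _ 0≤q (𝔼-mono t f≤g))
    (*-mono-≤ˡ _ (subst (ℚ._≤ 1ℚ ℚ.- q) (ℚₚ.+-inverseʳ q) (ℚₚ.+-monoˡ-≤ (ℚ.- q) q≤1))
      (𝔼-mono s f≤g))

  ℙr-mono : ∀ (t : Trial A) {P Q} (P? : Decidable P) (Q? : Decidable Q) →
    (∀ a → P a → Q a) → ℙr q t P? ℚ.≤ ℙr q t Q?
  ℙr-mono t P? Q? P⇒Q = 𝔼-mono t λ a → 𝟙-mono (P⇒Q a) (P? a) (Q? a)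

  0≤ℙr : ∀ (t : Trial A) {P} (P? : Decidable P) → 0ℚ ℚ.≤ ℙr q t P?
  0≤ℙr t P? = subst (ℚ._≤ ℙr q t P?) (𝔼-const q t 0ℚ) (𝔼-mono t λ a → 0≤𝟙 (P? a))

  ℙr≤1 : ∀ (t : Trial A) {P} (P? : Decidable P) → ℙr q t P? ℚ.≤ 1ℚ
  ℙr≤1 t P? = subst (ℙr q t P? ℚ.≤_) (𝔼-const q t 1ℚ) (𝔼-mono t λ a → 𝟙≤1 (P? a))

  ℙr-impossible : ∀ (t : Trial A) {P} (P? : Decidable P) {c} → 0ℚ ℚ.≤ c →
    (∀ a → ¬ P a) → ℙr q t P? ℚ.≤ c
  ℙr-impossible t P? {c} 0≤c ¬P = begin
    ℙr q t P?                ≤⟨ ℙr-mono t P? (λ _ → no id) ¬P ⟩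
    𝔼 q t (λ _ → 0ℚ)        ≡⟨ 𝔼-const q t 0ℚ ⟩
    0ℚ                       ≤⟨ 0≤c ⟩
    c                        ∎

  -- A condition that does not depend on the outcome may be assumed while the bound is proved; if it
  -- fails, the event is impossible.
  ℙr-given : ∀ (t : Trial A) {P} (d : Dec B) (P? : Decidable P) {c} → 0ℚ ℚ.≤ c →
    (B → ℙr q t P? ℚ.≤ c) → ℙr q t (λ a → d ×-dec P? a) ℚ.≤ c
  ℙr-given t d@(no ¬b) P? 0≤c P≤c = ℙr-impossible t (λ a → d ×-dec P? a) 0≤c λ _ (b , _) → ¬b b
  ℙr-given t d@(yes b) P? {c} 0≤c P≤c =
    ℚₚ.≤-trans (ℙr-mono t (λ a → d ×-dec P? a) P? (λ _ → proj₂)) (P≤c b)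

  ℙr-⊎ : ∀ (t : Trial A) {P Q} (P? : Decidable P) (Q? : Decidable Q) →
    ℙr q t (λ a → P? a ⊎-dec Q? a) ℚ.≤ ℙr q t P? ℚ.+ ℙr q t Q?
  ℙr-⊎ t P? Q? = ℚₚ.≤-trans (𝔼-mono t λ a → 𝟙-⊎ (P? a) (Q? a))
    (ℚₚ.≤-reflexive (𝔼-+ q t (λ a → 𝟙 (P? a)) (λ a → 𝟙 (Q? a))))

  -- The union bound.
  ℙr-∃ : ∀ (t : Trial A) {P : A → Fin m → Set} (P? : ∀ a z → Dec (P a z)) c →
    (∀ z → ℙr q t (λ a → P? a z) ℚ.≤ c) → ℙr q t (λ a → any? (P? a)) ℚ.≤ ι m ℚ.* c
  ℙr-∃ {m = zero}  t P? c P≤c = ℙr-impossible t (λ a → any? (P? a))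
    (ℚₚ.≤-reflexive (sym (ℚₚ.*-zeroˡ c))) λ { _ (() , _) }
  ℙr-∃ {m = suc m} t P? c P≤c = begin
    ℙr q t (λ a → any? (P? a))
      ≤⟨ ℙr-mono t (λ a → any? (P? a)) (λ a → P? a zero ⊎-dec any? (λ z → P? a (suc z)))
           (λ { a (zero , p) → inj₁ p ; a (suc z , p) → inj₂ (z , p) }) ⟩
    ℙr q t (λ a → P? a zero ⊎-dec any? (λ z → P? a (suc z)))
      ≤⟨ ℙr-⊎ t (λ a → P? a zero) (λ a → any? (λ z → P? a (suc z))) ⟩
    ℙr q t (λ a → P? a zero) ℚ.+ ℙr q t (λ a → any? (λ z → P? a (suc z)))
      ≤⟨ ℚₚ.+-mono-≤ (P≤c zero) (ℙr-∃ t (λ a z → P? a (suc z)) c (λ z → P≤c (suc z))) ⟩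
    c ℚ.+ ι m ℚ.* c
      ≡⟨ solve 2 (λ c i → c :+ i :* c := (con 1ℚ :+ i) :* c) refl c (ι m) ⟩
    ι (suc m) ℚ.* c ∎

  ℙr-coin : ℙr q coin (𝔹ₚ._≟ true) ≡ q
  ℙr-coin = solve 1 (λ q → q :* con 1ℚ :+ (con 1ℚ :- q) :* con 0ℚ := q) refl q

  true? : ∀ {n} (z : Fin n) (r : Vec Bool n) → Dec (lookup r z ≡ true)
  true? z r = lookup r z 𝔹ₚ.≟ true

  -- The toss at `z` is split off: it must succeed, and what remains of `P` implies an event `Q`
  -- about the other tosses, which are independent of it.
  ℙr-rows-insertAt : ∀ (z : Fin (suc n)) {P Q} (P? : Decidable P) (Q? : Decidable Q) →
    (∀ b r → P (insertAt r z b) → b ≡ true × Q r) →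
    ℙr q (rows (suc n)) P? ℚ.≤ q ℚ.* ℙr q (rows n) Q?
  ℙr-rows-insertAt {n} z P? Q? P⇒ = begin
    ℙr q (rows (suc n)) P?
      ≡⟨ 𝔼-rows-insertAt q z (λ r → 𝟙 (P? r)) ⟩
    𝔼 q coin (λ b → 𝔼 q (rows n) (λ r → 𝟙 (P? (insertAt r z b))))
      ≡⟨ 𝔼-⊗ q coin (rows n) (λ (b , r) → 𝟙 (P? (insertAt r z b))) ⟨
    ℙr q (coin ⊗ rows n) (λ (b , r) → P? (insertAt r z b))
      ≤⟨ ℙr-mono (coin ⊗ rows n) (λ (b , r) → P? (insertAt r z b))
           (λ (b , r) → (b 𝔹ₚ.≟ true) ×-dec Q? r) (λ (b , r) → P⇒ b r) ⟩
    ℙr q (coin ⊗ rows n) (λ (b , r) → (b 𝔹ₚ.≟ true) ×-dec Q? r)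
      ≡⟨ ℙr-indep q coin (rows n) (𝔹ₚ._≟ true) Q? ⟩
    ℙr q coin (𝔹ₚ._≟ true) ℚ.* ℙr q (rows n) Q?
      ≡⟨ cong (ℚ._* ℙr q (rows n) Q?) ℙr-coin ⟩
    q ℚ.* ℙr q (rows n) Q? ∎

  ℙr-lookup : ∀ (z : Fin n) → ℙr q (rows n) (true? z) ℚ.≤ q
  ℙr-lookup {suc n} z = begin
    ℙr q (rows (suc n)) (true? z)
      ≤⟨ ℙr-rows-insertAt z (true? z) U? (λ b r rz → trans (sym (insertAt-lookup r z b)) rz , _) ⟩
    q ℚ.* ℙr q (rows n) U?       ≤⟨ *-mono-≤ˡ _ 0≤q (ℙr≤1 (rows n) U?) ⟩
    q ℚ.* 1ℚ                     ≡⟨ ℚₚ.*-identityʳ q ⟩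
    q                            ∎

  ℙr-lookup² : ∀ {z w : Fin n} → z ≢ w →
    ℙr q (rows n) (λ r → true? z r ×-dec true? w r) ℚ.≤ q ℚ.* q
  ℙr-lookup² {suc n} {z} {w} z≢w = begin
    ℙr q (rows (suc n)) (λ r → true? z r ×-dec true? w r)
      -- In the row without its entry at `z`, the vertex `w` has the position `punchOut z≢w`.
      ≤⟨ ℙr-rows-insertAt z (λ r → true? z r ×-dec true? w r) (true? (punchOut z≢w))
           (λ b r (rz , rw) → trans (sym (insertAt-lookup r z b)) rz ,
              trans (sym (trans (cong (lookup (insertAt r z b)) (sym (punchIn-punchOut z≢w)))
                                (insertAt-punchIn r z b (punchOut z≢w)))) rw) ⟩
    q ℚ.* ℙr q (rows n) (true? (punchOut z≢w))
      ≤⟨ *-mono-≤ˡ _ 0≤q (ℙr-lookup (punchOut z≢w)) ⟩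
    q ℚ.* q ∎

  0≤q+q : 0ℚ ℚ.≤ q ℚ.+ q
  0≤q+q = 0≤+ 0≤q 0≤q

  q*ι-mono : ∀ {c} → q ℚ.* ι (suc n) ℚ.≤ c → q ℚ.* ι n ℚ.≤ c
  q*ι-mono {n} = ℚₚ.≤-trans (*-mono-≤ˡ (ι n) 0≤q
    (subst (ℚ._≤ ι (suc n)) (ℚₚ.+-identityˡ (ι n)) (ℚₚ.+-monoˡ-≤ (ι n) 0≤1)))

  private
    rowOf? : (y : Fin n) ((g , r) : LGraph n × Vec Bool n) → Dec (lookup r y ≡ true)
    rowOf? y (g , r) = true? y r

    via? : (y : Fin n) ((g , r) : LGraph n × Vec Bool n) (z : Fin n) →
      Dec (z ≢ y × Linked g z y × lookup r z ≡ true)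
    via? y (g , r) z = ¬? (z Finₚ.≟ y) ×-dec linked? g z y ×-dec true? z r

  -- Expose the edges at x last: x must be joined directly to y, or to
  -- some z ≢ y that is linked to y in the rest of the graph.
  ℙr-linked : q ℚ.* ι n ℚ.≤ ½ → ∀ {x y : Fin n} → x ≢ y →
    ℙr q (graphs n) (λ g → linked? g x y) ℚ.≤ q ℚ.+ q
  ℙr-linked {suc n} qn≤½ {x} {y} x≢y = begin
    ℙr q (graphs (suc n)) (λ g → linked? g x y)
      ≡⟨ 𝔼-graphs-insert q x (λ g → 𝟙 (linked? g x y)) ⟩
    𝔼 q (graphs n) (λ g → 𝔼 q (rows n) (λ r → 𝟙 (linked? (insert g x r) x y)))
      ≡⟨ 𝔼-⊗ q (graphs n) (rows n) (λ (g , r) → 𝟙 (linked? (insert g x r) x y)) ⟨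
    ℙr q t (λ (g , r) → linked? (insert g x r) x y)
      ≤⟨ ℙr-mono t (λ (g , r) → linked? (insert g x r) x y)
           (λ a → rowOf? y′ a ⊎-dec any? (via? y′ a))
           (λ (g , r) → first-step g r) ⟩
    ℙr q t (λ a → rowOf? y′ a ⊎-dec any? (via? y′ a))
      ≤⟨ ℙr-⊎ t (rowOf? y′) (λ a → any? (via? y′ a)) ⟩
    ℙr q t (rowOf? y′) ℚ.+ ℙr q t (λ a → any? (via? y′ a))
      ≤⟨ ℚₚ.+-mono-≤ direct (ℙr-∃ t (via? y′) ((q ℚ.+ q) ℚ.* q) indirect) ⟩
    q ℚ.+ ι n ℚ.* ((q ℚ.+ q) ℚ.* q)
      ≡⟨ solve 2 (λ q i → q :+ i :* ((q :+ q) :* q) := q :+ (q :* i) :* (q :+ q)) refl q (ι n) ⟩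
    q ℚ.+ (q ℚ.* ι n) ℚ.* (q ℚ.+ q)
      -- Here the hypothesis closes the induction: the detours cost at most half of `q ℚ.+ q`, which
      -- is as much as the direct edge.
      ≤⟨ ℚₚ.+-monoʳ-≤ q (*-mono-≤ʳ _ 0≤q+q (q*ι-mono {n} qn≤½)) ⟩
    q ℚ.+ ½ ℚ.* (q ℚ.+ q)
      ≡⟨ solve 1 (λ q → q :+ con ½ :* (q :+ q) := q :+ q) refl q ⟩
    q ℚ.+ q ∎
    where
    t = graphs n ⊗ rows n
    y′ = punchOut x≢y

    first-step : ∀ g r → Linked (insert g x r) x y →
      lookup r y′ ≡ true ⊎ ∃[ z ] z ≢ y′ × Linked g z y′ × lookup r z ≡ true
    first-step g r p
      with z , rz , l ← Linked-insert⇒LeavesTo g x r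
                          (subst (Linked (insert g x r) x) (sym (punchIn-punchOut x≢y)) p)
      -- As `Linked` is reflexive, `z ≡ y′` is beyond the induction hypothesis; it is the case of
      -- the direct edge.
      with z Finₚ.≟ y′
    ... | yes refl = inj₁ rz
    ... | no  z≢y′ = inj₂ (z , z≢y′ , l , rz)

    direct : ℙr q t (rowOf? y′) ℚ.≤ q
    direct = begin
      ℙr q t (rowOf? y′)
        ≡⟨ trans (𝔼-⊗ q (graphs n) (rows n) (λ (_ , r) → 𝟙 (true? y′ r))) (𝔼-const q (graphs n) _) ⟩
      ℙr q (rows n) (true? y′)
        ≤⟨ ℙr-lookup y′ ⟩
      q ∎

    -- The link lies in `g`, which is independent of the edges at `x`.
    indirect : ∀ z → ℙr q t (λ a → via? y′ a z) ℚ.≤ (q ℚ.+ q) ℚ.* q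
    indirect z = ℙr-given t (¬? (z Finₚ.≟ y′)) (λ (g , r) → linked? g z y′ ×-dec true? z r)
      (0≤* 0≤q+q 0≤q) λ z≢y′ → begin
      ℙr q t (λ (g , r) → linked? g z y′ ×-dec true? z r)
        ≡⟨ ℙr-indep q (graphs n) (rows n) (λ g → linked? g z y′) (true? z) ⟩
      ℙr q (graphs n) (λ g → linked? g z y′) ℚ.* ℙr q (rows n) (true? z)
        ≤⟨ *-mono-≤ʳ _ (0≤ℙr (rows n) (true? z)) (ℙr-linked (q*ι-mono {n} qn≤½) z≢y′) ⟩
      (q ℚ.+ q) ℚ.* ℙr q (rows n) (true? z)
        ≤⟨ *-mono-≤ˡ _ 0≤q+q (ℙr-lookup z) ⟩
      (q ℚ.+ q) ℚ.* q ∎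

  -- The link between `z` and `w` depends on `g` alone and the two new edges on `r` alone, so their
  -- bounds multiply.
  ℙr-closesCycle : q ℚ.* ι n ℚ.≤ ½ → ∀ (z w : Fin n) →
    ℙr q (graphs n ⊗ rows n) (λ (g , r) → closesCycle? g r z w) ℚ.≤ (q ℚ.+ q) ℚ.* (q ℚ.* q)
  ℙr-closesCycle {n} qn≤½ z w = ℙr-given t (¬? (z Finₚ.≟ w))
    (λ (g , r) → linked? g z w ×-dec both? r)
    (0≤* 0≤q+q (0≤* 0≤q 0≤q)) λ z≢w → begin
    ℙr q t (λ (g , r) → linked? g z w ×-dec both? r)
      ≡⟨ ℙr-indep q (graphs n) (rows n) (λ g → linked? g z w) both? ⟩
    ℙr q (graphs n) (λ g → linked? g z w) ℚ.* ℙr q (rows n) both?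
      ≤⟨ *-mono-≤ʳ _ (0≤ℙr (rows n) both?) (ℙr-linked qn≤½ z≢w) ⟩
    (q ℚ.+ q) ℚ.* ℙr q (rows n) both?
      ≤⟨ *-mono-≤ˡ _ 0≤q+q (ℙr-lookup² z≢w) ⟩
    (q ℚ.+ q) ℚ.* (q ℚ.* q) ∎
    where
    t = graphs n ⊗ rows n
    both? : (r : Vec Bool n) → Dec (lookup r z ≡ true × lookup r w ≡ true)
    both? r = true? z r ×-dec true? w r

  ℙr-cyclic : q ℚ.* ι n ℚ.≤ ½ → ℙr q (graphs n) cyclic? ℚ.≤ ½ ℚ.* (q ℚ.* ι n)
  ℙr-cyclic {zero}  _    = 0≤* (ℚₚ.nonNegative⁻¹ ½) (0≤* 0≤q ℚₚ.≤-refl)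
  ℙr-cyclic {suc n} qn≤½ = begin
    ℙr q (graphs (suc n)) cyclic?
      ≡⟨ 𝔼-graphs-suc q n (λ g → 𝟙 (cyclic? g)) ⟩
    𝔼 q (graphs n) (λ g → 𝔼 q (rows n) (λ r → 𝟙 (cyclic? (g ▹ r))))
      ≡⟨ 𝔼-⊗ q (graphs n) (rows n) (λ (g , r) → 𝟙 (cyclic? (g ▹ r))) ⟨
    ℙr q t (λ (g , r) → cyclic? (g ▹ r))
      ≤⟨ ℙr-⊎ t (λ (g , r) → cyclic? g) (λ (g , r) → any? λ z → any? λ w → closesCycle? g r z w) ⟩
    ℙr q t (λ (g , r) → cyclic? g) ℚ.+
    ℙr q t (λ (g , r) → any? λ z → any? λ w → closesCycle? g r z w)
      ≤⟨ ℚₚ.+-mono-≤ old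
           (ℙr-∃ t (λ (g , r) z → any? (closesCycle? g r z)) _ λ z →
             ℙr-∃ t (λ (g , r) → closesCycle? g r z) _ (ℙr-closesCycle qm≤½ z)) ⟩
    ½ ℚ.* (q ℚ.* ι n) ℚ.+ ι n ℚ.* (ι n ℚ.* ((q ℚ.+ q) ℚ.* (q ℚ.* q)))
      ≡⟨ solve 2 (λ q i → con ½ :* (q :* i) :+ i :* (i :* ((q :+ q) :* (q :* q)))
                       := con ½ :* (q :* i) :+ (q :+ q) :* ((q :* i) :* (q :* i))) refl q (ι n) ⟩
    ½ ℚ.* (q ℚ.* ι n) ℚ.+ (q ℚ.+ q) ℚ.* ((q ℚ.* ι n) ℚ.* (q ℚ.* ι n))
      -- The square of `q ℚ.* ι n` is at most ¼, so the new vertex contributes at most half of `q`.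
      ≤⟨ ℚₚ.+-monoʳ-≤ (½ ℚ.* (q ℚ.* ι n)) (*-mono-≤ˡ _ 0≤q+q
           (ℚₚ.≤-trans (*-mono-≤ʳ _ (0≤* 0≤q (0≤ι n)) qm≤½)
                       (*-mono-≤ˡ _ (ℚₚ.nonNegative⁻¹ ½) qm≤½))) ⟩
    ½ ℚ.* (q ℚ.* ι n) ℚ.+ (q ℚ.+ q) ℚ.* (½ ℚ.* ½)
      ≡⟨ solve 2 (λ q i → con ½ :* (q :* i) :+ (q :+ q) :* (con ½ :* con ½)
                       := con ½ :* (q :* (con 1ℚ :+ i))) refl q (ι n) ⟩
    ½ ℚ.* (q ℚ.* ι (suc n)) ∎
    where
    t = graphs n ⊗ rows n
    qm≤½ = q*ι-mono {n} qn≤½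
    old : ℙr q t (λ (g , r) → cyclic? g) ℚ.≤ ½ ℚ.* (q ℚ.* ι n)
    old = begin
      ℙr q t (λ (g , r) → cyclic? g)
        ≡⟨ trans (𝔼-⊗ q (graphs n) (rows n) (λ (g , _) → 𝟙 (cyclic? g)))
             (𝔼-cong q (graphs n) λ g → 𝔼-const q (rows n) (𝟙 (cyclic? g))) ⟩
      ℙr q (graphs n) cyclic?
        ≤⟨ ℙr-cyclic {n} qm≤½ ⟩
      ½ ℚ.* (q ℚ.* ι n) ∎

-- Continuity of 𝔼 at 0

-- For `q` and `f` bounded by 1 in absolute value, this is both a bound for `𝔼` and a Lipschitz
-- constant at 0. The right branch counts twice, for the two terms of its factor `1ℚ ℚ.- q`.
K : Trial A → ℚ
K (result a) = 1ℚ
K (toss t s) = K t ℚ.+ (K s ℚ.+ K s)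

0<K : ∀ (t : Trial A) → 0ℚ ℚ.< K t
0<K (result a) = ℚₚ.positive⁻¹ 1ℚ
0<K (toss t s) = ℚₚ.+-mono-< (0<K t) (ℚₚ.+-mono-< (0<K s) (0<K s))

1≤K : ∀ (t : Trial A) → 1ℚ ℚ.≤ K t
1≤K (result a) = ℚₚ.≤-refl
1≤K (toss t s) = ℚₚ.+-mono-≤ (1≤K t) (ℚₚ.<⇒≤ (ℚₚ.+-mono-< (0<K s) (0<K s)))

module _ {q : ℚ} (∣q∣≤1 : ℚ.∣ q ∣ ℚ.≤ 1ℚ) {f : A → ℚ} (∣f∣≤1 : ∀ a → ℚ.∣ f a ∣ ℚ.≤ 1ℚ) where

  open ℚₚ.≤-Reasoning

  ∣𝔼∣≤K : ∀ t → ℚ.∣ 𝔼 q t f ∣ ℚ.≤ K t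

  ∣q*𝔼∣≤ : ∀ t → ℚ.∣ q ℚ.* 𝔼 q t f ∣ ℚ.≤ ℚ.∣ q ∣ ℚ.* K t
  ∣q*𝔼∣≤ t = begin
    ℚ.∣ q ℚ.* 𝔼 q t f ∣         ≡⟨ ℚₚ.∣p*q∣≡∣p∣*∣q∣ q (𝔼 q t f) ⟩
    ℚ.∣ q ∣ ℚ.* ℚ.∣ 𝔼 q t f ∣   ≤⟨ *-mono-≤ˡ _ (ℚₚ.0≤∣p∣ q) (∣𝔼∣≤K t) ⟩
    ℚ.∣ q ∣ ℚ.* K t             ∎

  ∣q*𝔼∣≤K : ∀ t → ℚ.∣ q ℚ.* 𝔼 q t f ∣ ℚ.≤ K t
  ∣q*𝔼∣≤K t = begin
    ℚ.∣ q ℚ.* 𝔼 q t f ∣   ≤⟨ ∣q*𝔼∣≤ t ⟩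
    ℚ.∣ q ∣ ℚ.* K t       ≤⟨ *-mono-≤ʳ _ (ℚₚ.<⇒≤ (0<K t)) ∣q∣≤1 ⟩
    1ℚ ℚ.* K t            ≡⟨ ℚₚ.*-identityˡ (K t) ⟩
    K t                   ∎

  ∣x+y-z∣≤ : ∀ {a b c} x y z → ℚ.∣ x ∣ ℚ.≤ a → ℚ.∣ y ∣ ℚ.≤ b → ℚ.∣ z ∣ ℚ.≤ c →
    ℚ.∣ x ℚ.+ (y ℚ.- z) ∣ ℚ.≤ a ℚ.+ (b ℚ.+ c)
  ∣x+y-z∣≤ x y z x≤a y≤b z≤c = ℚₚ.≤-trans (ℚₚ.∣p+q∣≤∣p∣+∣q∣ x (y ℚ.- z))
    (ℚₚ.+-mono-≤ x≤a (ℚₚ.≤-trans (ℚₚ.∣p+q∣≤∣p∣+∣q∣ y (ℚ.- z))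
      (ℚₚ.+-mono-≤ y≤b (ℚₚ.≤-trans (ℚₚ.≤-reflexive (ℚₚ.∣-p∣≡∣p∣ z)) z≤c))))

  ∣𝔼∣≤K (result a) = ∣f∣≤1 a
  ∣𝔼∣≤K (toss t s) = begin
    ℚ.∣ q ℚ.* x ℚ.+ (1ℚ ℚ.- q) ℚ.* y ∣
      ≡⟨ cong ℚ.∣_∣ (solve 3 (λ q x y →
           q :* x :+ (con 1ℚ :- q) :* y := q :* x :+ (y :- q :* y)) refl q x y) ⟩
    ℚ.∣ q ℚ.* x ℚ.+ (y ℚ.- q ℚ.* y) ∣
      ≤⟨ ∣x+y-z∣≤ (q ℚ.* x) y (q ℚ.* y) (∣q*𝔼∣≤K t) (∣𝔼∣≤K s) (∣q*𝔼∣≤K s) ⟩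
    K t ℚ.+ (K s ℚ.+ K s) ∎
    where
    x = 𝔼 q t f
    y = 𝔼 q s f

  ∣𝔼-𝔼₀∣≤ : ∀ t → ℚ.∣ 𝔼 q t f ℚ.- 𝔼 0ℚ t f ∣ ℚ.≤ ℚ.∣ q ∣ ℚ.* K t
  ∣𝔼-𝔼₀∣≤ (result a) = begin
    ℚ.∣ f a ℚ.- f a ∣   ≡⟨ cong ℚ.∣_∣ (ℚₚ.+-inverseʳ (f a)) ⟩
    0ℚ                  ≤⟨ ℚₚ.0≤∣p∣ q ⟩
    ℚ.∣ q ∣             ≡⟨ ℚₚ.*-identityʳ ℚ.∣ q ∣ ⟨
    ℚ.∣ q ∣ ℚ.* 1ℚ      ∎
  ∣𝔼-𝔼₀∣≤ (toss t s) = begin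
    ℚ.∣ (q ℚ.* x ℚ.+ (1ℚ ℚ.- q) ℚ.* y) ℚ.- (0ℚ ℚ.* x₀ ℚ.+ (1ℚ ℚ.- 0ℚ) ℚ.* y₀) ∣
      -- Each summand of the new form is of order `q`: two have it as a factor, and the third is the
      -- same difference for a subtree. The value `x₀` drops out, having the factor 0.
      ≡⟨ cong ℚ.∣_∣ (solve 5 (λ q x y x₀ y₀ →
           (q :* x :+ (con 1ℚ :- q) :* y) :- (con 0ℚ :* x₀ :+ (con 1ℚ :- con 0ℚ) :* y₀)
           := q :* x :+ ((y :- y₀) :- q :* y)) refl q x y x₀ y₀) ⟩
    ℚ.∣ q ℚ.* x ℚ.+ ((y ℚ.- y₀) ℚ.- q ℚ.* y) ∣
      ≤⟨ ∣x+y-z∣≤ (q ℚ.* x) (y ℚ.- y₀) (q ℚ.* y) (∣q*𝔼∣≤ t) (∣𝔼-𝔼₀∣≤ s) (∣q*𝔼∣≤ s) ⟩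
    ℚ.∣ q ∣ ℚ.* K t ℚ.+ (ℚ.∣ q ∣ ℚ.* K s ℚ.+ ℚ.∣ q ∣ ℚ.* K s)
      ≡⟨ solve 3 (λ c a b → c :* a :+ (c :* b :+ c :* b) := c :* (a :+ (b :+ b)))
           refl ℚ.∣ q ∣ (K t) (K s) ⟩
    ℚ.∣ q ∣ ℚ.* (K t ℚ.+ (K s ℚ.+ K s)) ∎
    where
    x  = 𝔼 q t f
    y  = 𝔼 q s f
    x₀ = 𝔼 0ℚ t f
    y₀ = 𝔼 0ℚ s f

∣𝟙∣≤1 : (d : Dec A) → ℚ.∣ 𝟙 d ∣ ℚ.≤ 1ℚ
∣𝟙∣≤1 d = ℚₚ.≤-trans (ℚₚ.≤-reflexive (ℚₚ.0≤p⇒∣p∣≡p (0≤𝟙 d))) (𝟙≤1 d)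

-- How far a term of `p` may lie below 0: with `K (graphs n)` for `c`, the resulting error in the
-- probability is at most ¼.
tolerance : ∀ c → 0ℚ ℚ.< c → ∃[ δ ] 0ℚ ℚ.< δ × δ ℚ.* c ≡ ¼
tolerance c 0<c = ¼ ℚ.* c⁻¹
  , ℚₚ.positive⁻¹ (¼ ℚ.* c⁻¹) {{ℚₚ.pos*pos⇒pos ¼ c⁻¹ {{ℚₚ.1/pos⇒pos c {{c>0}}}}}}
  , trans (ℚₚ.*-assoc ¼ c⁻¹ c) (trans (cong (¼ ℚ.*_) (ℚₚ.*-inverseˡ c {{c≢0}})) (ℚₚ.*-identityʳ ¼))
  where
  c>0 = ℚ.positive 0<c
  c≢0 = ℚₚ.pos⇒nonZero c {{c>0}}
  c⁻¹ = ℚ.1/_ c {{c≢0}}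

-- Events that imply a cycle

module _ {A : Pred (LGraph n) 0ℓ} (A? : Decidable A) (A⇒cyclic : ∀ g → A g → Cyclic g) where

  open ℚₚ.≤-Reasoning

  ℙr≤¼ : ∀ {q} → 0ℚ ℚ.≤ q → q ℚ.≤ 1ℚ → q ℚ.* ι n ℚ.≤ ½ → ℙr q (graphs n) A? ℚ.≤ ¼
  ℙr≤¼ {q} 0≤q q≤1 qn≤½ = begin
    ℙr q (graphs n) A?        ≤⟨ ℙr-mono 0≤q q≤1 (graphs n) A? cyclic? A⇒cyclic ⟩
    ℙr q (graphs n) cyclic?   ≤⟨ ℙr-cyclic 0≤q q≤1 {n} qn≤½ ⟩
    ½ ℚ.* (q ℚ.* ι n)         ≤⟨ *-mono-≤ˡ _ (ℚₚ.nonNegative⁻¹ ½) qn≤½ ⟩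
    ¼                         ∎

  -- For nonnegative `q` the bound ¼ applies directly. For negative `q` it applies at 0, and
  -- continuity adds at most another ¼.
  ℙr≤½ : .{{_ : ℕ.NonZero n}} → ∀ {q δ} → δ ℚ.* K (graphs n) ≡ ¼ → 0ℚ ℚ.≤ q ℚ.+ δ →
    q ℚ.≤ ½ ℚ.* (ℤ.+ 1 ℚ./ n) → ℙr q (graphs n) A? ℚ.≤ ½
  ℙr≤½ {q} {δ} δK≡¼ 0≤q+δ q≤1/2n with ℚₚ.≤-total 0ℚ q
  ... | inj₁ 0≤q = ℚₚ.≤-trans (ℙr≤¼ 0≤q q≤1 qn≤½) ¼≤½
    where
    ¼≤½ : ¼ ℚ.≤ ½
    ¼≤½ = ℚₚ.≤ᵇ⇒≤ _

    qn≤½ : q ℚ.* ι n ℚ.≤ ½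
    qn≤½ = begin
      q ℚ.* ι n                          ≤⟨ *-mono-≤ʳ _ (0≤ι n) q≤1/2n ⟩
      ½ ℚ.* (ℤ.+ 1 ℚ./ n) ℚ.* ι n        ≡⟨ ℚₚ.*-assoc ½ (ℤ.+ 1 ℚ./ n) (ι n) ⟩
      ½ ℚ.* ((ℤ.+ 1 ℚ./ n) ℚ.* ι n)      ≡⟨ cong (½ ℚ.*_) (1/n*ι n) ⟩
      ½                                  ∎

    1≤ι : ∀ n .{{_ : ℕ.NonZero n}} → 1ℚ ℚ.≤ ι n
    1≤ι (suc n) = subst (ℚ._≤ ι (suc n)) (ℚₚ.+-identityʳ 1ℚ) (ℚₚ.+-monoʳ-≤ 1ℚ (0≤ι n))

    q≤1 : q ℚ.≤ 1ℚ
    q≤1 = begin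
      q              ≡⟨ ℚₚ.*-identityʳ q ⟨
      q ℚ.* 1ℚ       ≤⟨ *-mono-≤ˡ _ 0≤q (1≤ι n) ⟩
      q ℚ.* ι n      ≤⟨ qn≤½ ⟩
      ½              ≤⟨ ℚₚ.≤ᵇ⇒≤ _ ⟩
      1ℚ             ∎
  ... | inj₂ q≤0 = begin
    F                          ≡⟨ solve 2 (λ x y → x := y :+ (x :- y)) refl F F₀ ⟩
    F₀ ℚ.+ (F ℚ.- F₀)          ≤⟨ ℚₚ.+-mono-≤ (ℙr≤¼ ℚₚ.≤-refl 0≤1 0n≤½) (p≤∣p∣ (F ℚ.- F₀)) ⟩
    ¼ ℚ.+ ℚ.∣ F ℚ.- F₀ ∣       ≤⟨ ℚₚ.+-monoʳ-≤ ¼ (ℚₚ.≤-trans near ∣q∣K≤¼) ⟩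
    ½                          ∎
    where
    F F₀ : ℚ
    F  = ℙr q (graphs n) A?
    F₀ = ℙr 0ℚ (graphs n) A?

    0n≤½ : 0ℚ ℚ.* ι n ℚ.≤ ½
    0n≤½ = subst (ℚ._≤ ½) (sym (ℚₚ.*-zeroˡ (ι n))) (ℚₚ.nonNegative⁻¹ ½)

    ∣q∣≤δ : ℚ.∣ q ∣ ℚ.≤ δ
    ∣q∣≤δ = begin
      ℚ.∣ q ∣                     ≡⟨ ℚₚ.∣-p∣≡∣p∣ q ⟨
      ℚ.∣ ℚ.- q ∣                 ≡⟨ ℚₚ.0≤p⇒∣p∣≡p (ℚₚ.neg-antimono-≤ q≤0) ⟩
      ℚ.- q                       ≡⟨ ℚₚ.+-identityʳ (ℚ.- q) ⟨
      ℚ.- q ℚ.+ 0ℚ                ≤⟨ ℚₚ.+-monoʳ-≤ (ℚ.- q) 0≤q+δ ⟩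
      ℚ.- q ℚ.+ (q ℚ.+ δ)         ≡⟨ solve 2 (λ q d → :- q :+ (q :+ d) := d) refl q δ ⟩
      δ                           ∎

    ∣q∣K≤¼ : ℚ.∣ q ∣ ℚ.* K (graphs n) ℚ.≤ ¼
    ∣q∣K≤¼ = begin
      ℚ.∣ q ∣ ℚ.* K (graphs n)    ≤⟨ *-mono-≤ʳ _ (ℚₚ.<⇒≤ (0<K (graphs n))) ∣q∣≤δ ⟩
      δ ℚ.* K (graphs n)          ≡⟨ δK≡¼ ⟩
      ¼                           ∎

    -- The Lipschitz estimate presupposes this; it follows since `K` is at least 1.
    ∣q∣≤1 : ℚ.∣ q ∣ ℚ.≤ 1ℚ
    ∣q∣≤1 = begin
      ℚ.∣ q ∣                     ≡⟨ ℚₚ.*-identityʳ ℚ.∣ q ∣ ⟨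
      ℚ.∣ q ∣ ℚ.* 1ℚ              ≤⟨ *-mono-≤ˡ _ (ℚₚ.0≤∣p∣ q) (1≤K (graphs n)) ⟩
      ℚ.∣ q ∣ ℚ.* K (graphs n)    ≤⟨ ∣q∣K≤¼ ⟩
      ¼                           ≤⟨ ℚₚ.≤ᵇ⇒≤ _ ⟩
      1ℚ                          ∎

    near : ℚ.∣ F ℚ.- F₀ ∣ ℚ.≤ ℚ.∣ q ∣ ℚ.* K (graphs n)
    near = ∣𝔼-𝔼₀∣≤ ∣q∣≤1 (λ g → ∣𝟙∣≤1 (A? g)) (graphs n)

-- The approximants of ℙ as expectations

Σ[_] : List A → (A → ℚ) → ℚ
Σ[ [] ]     f = 0ℚ
Σ[ x ∷ xs ] f = f x ℚ.+ Σ[ xs ] f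

Σ-cong : ∀ (xs : List A) {f g : A → ℚ} → (∀ x → f x ≡ g x) → Σ[ xs ] f ≡ Σ[ xs ] g
Σ-cong []       f≡g = refl
Σ-cong (x ∷ xs) f≡g = cong₂ ℚ._+_ (f≡g x) (Σ-cong xs f≡g)

Σ-*ˡ : ∀ (xs : List A) c f → Σ[ xs ] (λ x → c ℚ.* f x) ≡ c ℚ.* Σ[ xs ] f
Σ-*ˡ []       c f = sym (ℚₚ.*-zeroʳ c)
Σ-*ˡ (x ∷ xs) c f =
  trans (cong (c ℚ.* f x ℚ.+_) (Σ-*ˡ xs c f)) (sym (ℚₚ.*-distribˡ-+ c (f x) (Σ[ xs ] f)))

Σ-map-++ : ∀ (h : A → B) xs ys f → Σ[ map h xs ++ ys ] f ≡ Σ[ xs ] (f ∘ h) ℚ.+ Σ[ ys ] f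
Σ-map-++ h []       ys f = sym (ℚₚ.+-identityˡ (Σ[ ys ] f))
Σ-map-++ h (x ∷ xs) ys f =
  trans (cong (f (h x) ℚ.+_) (Σ-map-++ h xs ys f)) (sym (ℚₚ.+-assoc (f (h x)) _ _))

Σ-cartesianProductWith : ∀ {C : Set} (h : A → B → C) xs ys f →
  Σ[ cartesianProductWith h xs ys ] f ≡ Σ[ xs ] (λ x → Σ[ ys ] (λ y → f (h x y)))
Σ-cartesianProductWith h []       ys f = refl
Σ-cartesianProductWith h (x ∷ xs) ys f = trans (Σ-map-++ (h x) ys _ f)
  (cong (Σ[ ys ] (f ∘ h x) ℚ.+_) (Σ-cartesianProductWith h xs ys f))

Σ-filter : ∀ {P : Pred A 0ℓ} (P? : Decidable P) xs f →
  Σ[ filter P? xs ] f ≡ Σ[ xs ] (λ x → f x ℚ.* 𝟙 (P? x))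
Σ-filter P? []       f = refl
Σ-filter P? (x ∷ xs) f with does (P? x)
... | true  = cong₂ ℚ._+_ (sym (ℚₚ.*-identityʳ (f x))) (Σ-filter P? xs f)
... | false = trans (Σ-filter P? xs f) (sym (trans
  (cong (ℚ._+ Σ[ xs ] (λ x → f x ℚ.* 𝟙 (P? x))) (ℚₚ.*-zeroʳ (f x))) (ℚₚ.+-identityˡ _)))

seq-foldr : ∀ (h : A → ℝ) xs k →
  seq (foldr _+_ 0ℝ (map h xs)) k ≡ Σ[ xs ] (λ x → seq (h x) k)
seq-foldr h []       k = refl
seq-foldr h (x ∷ xs) k = cong (seq (h x) k ℚ.+_) (seq-foldr h xs k)

module _ (p : ℝ) (k : ℕ) where

  private
    q = seq p k

    rowW : Vec Bool n → ℚ
    rowW r = seq (rowWeight p r) k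

    W : LGraph n → ℚ
    W g = seq (weight p g) k

  open ≡-Reasoning

  -- The `k`-th term of a real sum or product is by definition the sum or product of the `k`-th
  -- terms. The list and the tree both split on the first entry, and the weights are the products
  -- along the branches.
  Σ-rows : ∀ n f → Σ[ allRows n ] (λ r → rowW r ℚ.* f r) ≡ 𝔼 q (rows n) f
  Σ-rows zero    f = trans (ℚₚ.+-identityʳ (1ℚ ℚ.* f [])) (ℚₚ.*-identityˡ (f []))
  Σ-rows (suc n) f = begin
    Σ[ allRows (suc n) ] (λ r → rowW r ℚ.* f r)
      ≡⟨ Σ-cartesianProductWith _∷_ (true ∷ false ∷ []) (allRows n) (λ r → rowW r ℚ.* f r) ⟩
    Σ[ allRows n ] (λ r → q ℚ.* rowW r ℚ.* f (true ∷ r)) ℚ.+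
    (Σ[ allRows n ] (λ r → (1ℚ ℚ.- q) ℚ.* rowW r ℚ.* f (false ∷ r)) ℚ.+ 0ℚ)
      ≡⟨ cong₂ ℚ._+_ (scaled q true) (trans (ℚₚ.+-identityʳ _) (scaled (1ℚ ℚ.- q) false)) ⟩
    q ℚ.* 𝔼 q (rows n) (λ r → f (true ∷ r)) ℚ.+ (1ℚ ℚ.- q) ℚ.* 𝔼 q (rows n) (λ r → f (false ∷ r))
      ≡⟨ 𝔼-rows-suc q n f ⟨
    𝔼 q (rows (suc n)) f ∎
    where
    scaled : ∀ c b → Σ[ allRows n ] (λ r → c ℚ.* rowW r ℚ.* f (b ∷ r)) ≡
                    c ℚ.* 𝔼 q (rows n) (λ r → f (b ∷ r))
    scaled c b = begin
      Σ[ allRows n ] (λ r → c ℚ.* rowW r ℚ.* f (b ∷ r))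
        ≡⟨ Σ-cong (allRows n) (λ r → ℚₚ.*-assoc c (rowW r) (f (b ∷ r))) ⟩
      Σ[ allRows n ] (λ r → c ℚ.* (rowW r ℚ.* f (b ∷ r)))
        ≡⟨ Σ-*ˡ (allRows n) c (λ r → rowW r ℚ.* f (b ∷ r)) ⟩
      c ℚ.* Σ[ allRows n ] (λ r → rowW r ℚ.* f (b ∷ r))
        ≡⟨ cong (c ℚ.*_) (Σ-rows n (λ r → f (b ∷ r))) ⟩
      c ℚ.* 𝔼 q (rows n) (λ r → f (b ∷ r)) ∎

  Σ-graphs : ∀ n f → Σ[ allLGraphs n ] (λ g → W g ℚ.* f g) ≡ 𝔼 q (graphs n) f
  Σ-graphs zero    f = trans (ℚₚ.+-identityʳ (1ℚ ℚ.* f ∅)) (ℚₚ.*-identityˡ (f ∅))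
  Σ-graphs (suc n) f = begin
    Σ[ allLGraphs (suc n) ] (λ g → W g ℚ.* f g)
      ≡⟨ Σ-cartesianProductWith _▹_ (allLGraphs n) (allRows n) (λ g → W g ℚ.* f g) ⟩
    Σ[ allLGraphs n ] (λ g → Σ[ allRows n ] (λ r → W g ℚ.* rowW r ℚ.* f (g ▹ r)))
      -- Summing over the rows first leaves a function of `g`, to which the induction hypothesis
      -- applies.
      ≡⟨ Σ-cong (allLGraphs n) (λ g → trans
           (Σ-cong (allRows n) (λ r → ℚₚ.*-assoc (W g) (rowW r) (f (g ▹ r))))
           (trans (Σ-*ˡ (allRows n) (W g) (λ r → rowW r ℚ.* f (g ▹ r)))
             (cong (W g ℚ.*_) (Σ-rows n (λ r → f (g ▹ r)))))) ⟩
    Σ[ allLGraphs n ] (λ g → W g ℚ.* 𝔼 q (rows n) (λ r → f (g ▹ r)))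
      ≡⟨ Σ-graphs n (λ g → 𝔼 q (rows n) (λ r → f (g ▹ r))) ⟩
    𝔼 q (graphs n) (λ g → 𝔼 q (rows n) (λ r → f (g ▹ r)))
      ≡⟨ 𝔼-graphs-suc q n f ⟨
    𝔼 q (graphs (suc n)) f ∎

  -- Each term of `ℙ` is the polynomial `𝔼` at the corresponding term of `p`, wherever that term
  -- lies.
  seq-ℙ : ∀ {A : Pred (LGraph n) 0ℓ} (A? : Decidable A) → seq (ℙ n p A?) k ≡ ℙr q (graphs n) A?
  seq-ℙ {n} A? = begin
    seq (ℙ n p A?) k
      ≡⟨ seq-foldr (weight p) (filter A? (allLGraphs n)) k ⟩
    Σ[ filter A? (allLGraphs n) ] W                  ≡⟨ Σ-filter A? (allLGraphs n) W ⟩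
    Σ[ allLGraphs n ] (λ g → W g ℚ.* 𝟙 (A? g))       ≡⟨ Σ-graphs n (λ g → 𝟙 (A? g)) ⟩
    ℙr q (graphs n) A?                               ∎

-- From rational terms to real probabilities

cyclic-unlikely : .{{_ : ℕ.NonZero n}} {A : Pred (LGraph n) 0ℓ} → (∀ g → A g → Cyclic g) →
  ∀ p → 0ℝ ≤ p → p ≤ fromℚ ¼ * fromℚ (ℤ.+ 1 ℚ./ n) → ¬ (A With-Probability>½ p)
-- The strict inequality leaves a gap `η` above ½ at all late terms, whereas late terms of the
-- probability are at most ½; one late index `k` gives the contradiction.
cyclic-unlikely {n} A⇒cyclic p 0≤p p≤¼/n (A? , η , 0<η , N₁ , ½<ℙ) =
  ℚₚ.<-irrefl refl (ℚₚ.<-≤-trans ½<½+η (ℚₚ.≤-trans (½<ℙ k (ℕₚ.m≤m⊔n N₁ M))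
    (subst (ℚ._≤ ½) (sym (seq-ℙ p k A?)) (ℙr≤½ A? A⇒cyclic (proj₂ (proj₂ tol)) 0≤q+δ q≤1/2n))))
  where
  ½<½+η : ½ ℚ.< ½ ℚ.+ η
  ½<½+η = subst (ℚ._< ½ ℚ.+ η) (ℚₚ.+-identityʳ ½) (ℚₚ.+-monoʳ-< ½ 0<η)

  1/n : ℚ
  1/n = ℤ.+ 1 ℚ./ n

  0<¼/n : 0ℚ ℚ.< ¼ ℚ.* 1/n
  0<¼/n = ℚₚ.positive⁻¹ (¼ ℚ.* 1/n) {{ℚₚ.pos*pos⇒pos ¼ 1/n {{ℚₚ.normalize-pos 1 n}}}}

  tol = tolerance (K (graphs n)) (0<K (graphs n))
  δ = proj₁ tol

  lower = 0≤p δ (proj₁ (proj₂ tol))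
  -- The assumed bound with ¼ and an error of the same size add up to the bound with ½ that `ℙr≤½`
  -- asks for.
  upper = p≤¼/n (¼ ℚ.* 1/n) 0<¼/n
  N₂ = proj₁ lower
  N₃ = proj₁ upper
  M = N₂ ⊔ N₃
  k = N₁ ⊔ M
  M≤k = ℕₚ.m≤n⊔m N₁ M

  0≤q+δ : 0ℚ ℚ.≤ seq p k ℚ.+ δ
  0≤q+δ = proj₂ lower k (ℕₚ.≤-trans (ℕₚ.m≤m⊔n N₂ N₃) M≤k)

  q≤1/2n : seq p k ℚ.≤ ½ ℚ.* 1/n
  q≤1/2n = ℚₚ.≤-trans (proj₂ upper k (ℕₚ.≤-trans (ℕₚ.m≤n⊔m N₂ N₃) M≤k))
    (ℚₚ.≤-reflexive (sym (ℚₚ.*-distribʳ-+ 1/n ¼ ¼)))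

-- One argument for both numbers: `P` stands for either list of requirements, each of which fixes
-- the chromatic number at 3.
no-induced-χ≡3 : .{{_ : ℕ.NonZero n}} (P : Graph → Set) → (∀ G → P G → χ[ G ]≡ 3) →
  ∀ p → 0ℝ ≤ p → p ≤ fromℚ ¼ * fromℚ (ℤ.+ 1 ℚ./ n) →
  IsLargestPositiveOr0 (λ k → HasInduced P {n} k With-Probability>½ p) 0
no-induced-χ≡3 {n} P P⇒χ≡3 p 0≤p p≤¼/n = inj₂ (refl , λ k _ →
  cyclic-unlikely {A = HasInduced P k}
    (λ g (W , _ , PW) → χ≡3⇒cyclic g W (P⇒χ≡3 (g [ W ]) PW)) p 0≤p p≤¼/n)

theorem13 : (p : ℕ → ℝ) → (∀ n → 0ℝ ≤ p n × p n ≤ 1ℝ) → p =o[1/n] →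
    ∃[ N ] (∀ n → N ℕ.≤ n → (u[ 2 , n , p n ]≡ 0) × (u′[ 2 , n , p n ]≡ 0))
-- The `suc` makes `n` nonzero, so that the fraction `1/n` is defined.
theorem13 p 0≤p≤1 p=o = suc (proj₁ small) , λ n N<n →
  let instance n≢0 = ℕ.>-nonZero (ℕₚ.≤-trans (ℕ.s≤s ℕ.z≤n) N<n)
      0≤p = proj₁ (0≤p≤1 n)
      p≤¼/n = proj₂ (proj₂ small n (ℕₚ.<⇒≤ N<n))
  in no-induced-χ≡3 (λ G → IsDiameterGraph 2 G × χ[ G ]≡ 3)
       (λ _ (_ , χ≡3) → χ≡3) (p n) 0≤p p≤¼/n
   , no-induced-χ≡3 (λ G → IsDiameterGraph 2 G × χ[ G ]≡ 3 × Connected G)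
       (λ _ (_ , χ≡3 , _) → χ≡3) (p n) 0≤p p≤¼/n
  where
  small : Eventually λ n → .{{_ : ℕ.NonZero n}} →
    - (fromℚ ¼ * fromℚ (ℤ.+ 1 ℚ./ n)) ≤ p n × p n ≤ fromℚ ¼ * fromℚ (ℤ.+ 1 ℚ./ n)
  small = p=o (fromℚ ¼) (¼ , ℚₚ.positive⁻¹ ¼ , 0 , λ _ _ → ℚₚ.≤-refl)
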